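{- Let $(K,\mathcal{L})$ be a $C$-minimal valued field and let $f\colon X\subseteq K\to K$ be a definable local $C$-isomorphism. Then there is a finite subset $F\subseteq X$ such that $f|(X\setminus F)$ locally factorizes over $\Gamma$ through a definable function $h$.
   Context: Valued fields $(K,v)$ are non-trivially valued; $\Gamma_K$ is the value group. Closed balls are $B(a,\gamma)=\{x\in K: v(x-a)\geq\gamma\}$ for $a \in K$, $\gamma\in\Gamma_K\cup\{+\infty\}$; open balls are $B^\circ(a,\gamma)=\{x\in K: v(x-a)>\gamma\}$ for $a\in K$, $\gamma\in\Gamma_K\cup\{ -\infty\}$ (so points are closed balls and $K$ is an open ball). A ball is a closed or an open ball. $\mathcal{L}_{div}=(+,-,\cdot,0,1,\mathrm{div})$ is the language of valued fields, with $\mathrm{div}(x,y)$ interpreted as $v(x)\leq v(y)$. Let $K$ be an algebraically closed valued field and $(K,\mathcal{L})$ an expansion of $(K,\mathcal{L}_{div})$ ($\mathcal{L}\supseteq\mathcal{L}_{div}$). $(K,\mathcal{L})$ is $C$-minimal (a "$C$-minimal valued field") if for every structure $(K',\mathcal{L})$ elementarily equivalent to it, every $\mathcal{L}$-definable subset of $K'$ is a boolean combination of balls. "Definable" means $\mathcal{L}$-definable with parameters; for subsets of (products involving) $\Gamma_K$ it means interpretable. The $C$-relation on $K$ is $C(x,y,z)\Leftrightarrow v(x-y)=v(x-z)<v(y-z)$. For an open ball $B\subseteq K$, a function $f\colon B\to K$ is a $C$-isomorphism if $f(B)$ is an open ball and for all $x,y,z\in B$, $C(x,y,z)\Leftrightarrow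 C(f(x),f(y),f(z))$. A function $f\colon X\subseteq K\to K$ is a local $C$-isomorphism if every $x\in X$ lies in an open ball $B\subseteq X$ such that $f|B$ is a $C$-isomorphism. A function $f\colon X\subseteq K\to K$ factorizes over $\Gamma$ through a (possibly partial) function $h\colon\Gamma_K\to\Gamma_K$ if $v(f(x)-f(y))=h(v(x-y))$ for all distinct $x,y\in X$. For $h\colon Y\subseteq X\times\Gamma_K\to\Gamma_K$, with $h_x(\gamma):=h(x,\gamma)$, $f$ locally factorizes over $\Gamma$ through $h$ if for every $x\in X$ there is an open ball $B_x\subseteq X$ containing $x$ such that $f|B_x$ factorizes over $\Gamma$ through $h_x$. -}

module Defs where

open import Level using (Level; suc; _⊔_)
open import Algebra.Bundles using (CommutativeRing; AbelianGroup; Semiring)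
open import Data.Empty.Polymorphic using (⊥)
open import Data.Fin.Base using (Fin; toℕ; fromℕ)
open import Data.Fin.Patterns using (0F; 1F)
open import Data.List.Base using (List)
open import Data.Nat.Base using (ℕ) renaming (suc to 1+_; _+_ to _+ℕ_)
open import Data.Product.Base using (Σ; Σ-syntax; ∃; ∃-syntax; _×_; _,_; proj₁; proj₂)
open import Data.Product.Relation.Binary.Pointwise.NonDependent using (×-setoid)
open import Data.Sum.Base using (_⊎_; inj₁; inj₂)
open import Data.Vec.Functional using (Vector; []; _∷_; _++_; take; drop)
open import Data.Unit.Polymorphic.Base using (⊤)
open import Function.Base using (_∘_)
open import Function.Bundles using (_⇔_)
open import Relation.Binary.Bundles using (Setoid)
open import Relation.Binary.Core using (Rel)
open import Relation.Binary.Definitions using (_Respects_; _Respectsʳ_)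
open import Relation.Binary.PropositionalEquality.Core using (_≡_)
open import Relation.Binary.Structures using (IsTotalOrder; module IsPreorder)
open import Relation.Nullary using (¬_)
open import Relation.Nullary.Construct.Add.Infimum using (_₋; ⊥₋)
open import Relation.Nullary.Construct.Add.Point using ([_])
open import Relation.Nullary.Construct.Add.Supremum using (_⁺; ⊤⁺)
open import Relation.Unary using (Pred; _∈_; _⊆_; _≐_; _∩_; _∪_; ∁)
import Algebra.Definitions.RawSemiring as RawSemiringDefs
import Data.List.Membership.Setoid as ListMembership
import Data.List.Membership.Setoid.Properties as ListMembershipₚ
import Relation.Binary.Construct.Add.Supremum.Equality as SupEq
import Relation.Binary.Construct.Add.Supremum.NonStrict as SupNonStrict
import Relation.Binary.Construct.Add.Supremum.Strict as SupStrict
import Relation.Binary.Construct.NonStrictToStrict as ToStrict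

private
  variable
    ℓ : Level

------------------------------------------------------------------------
-- Classical foundations

-- The axiom of choice in the form "every quotient map has a section": each
-- setoid has a function picking one representative per equivalence class.
-- (The intensional form ∀x∃y ⇒ ∃f∀x is a theorem of type theory; this
-- extensional form is not.)
SetoidChoice : ∀ a b → Set (suc (a ⊔ b))
SetoidChoice a b = (S : Setoid a b) → let open Setoid S in
  Σ[ r ∈ (Carrier → Carrier) ]
    (∀ x → x ≈ r x) × (∀ {x y} → x ≈ y → r x ≡ r y)

------------------------------------------------------------------------
-- First-order logic

record Language ℓ : Set (suc ℓ) where
  field
    Func : ℕ → Set ℓ
    Reln : ℕ → Set ℓ

_⊕_ : Language ℓ → Language ℓ → Language ℓ
L ⊕ E = record
  { Func = λ n → Language.Func L n ⊎ Language.Func E n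
  ; Reln = λ n → Language.Reln L n ⊎ Language.Reln E n
  }

module _ (L : Language ℓ) where
  open Language L

  data Term (n : ℕ) : Set ℓ where
    var  : Fin n → Term n
    func : ∀ {k} → Func k → (Fin k → Term n) → Term n

  -- Variables are de Bruijn indices: the quantifiers bind variable 0.
  data Formula (n : ℕ) : Set ℓ where
    false       : Formula n
    equal       : Term n → Term n → Formula n
    reln        : ∀ {k} → Reln k → (Fin k → Term n) → Formula n
    and or imp  : Formula n → Formula n → Formula n
    all ex      : Formula (1+ n) → Formula n

  -- The logical equality symbol denotes the equality _≈_ of the setoid S.
  record Interpretation (S : Setoid ℓ ℓ) : Set (suc ℓ) where
    open Setoid S
    field
      fun      : ∀ {k} → Func k → Vector Carrier k → Carrier
      fun-cong : ∀ {k} (g : Func k) {xs ys : Vector Carrier k} →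
                 (∀ i → xs i ≈ ys i) → fun g xs ≈ fun g ys
      rel      : ∀ {k} → Reln k → Vector Carrier k → Set ℓ
      rel-resp : ∀ {k} (R : Reln k) {xs ys : Vector Carrier k} →
                 (∀ i → xs i ≈ ys i) → rel R xs → rel R ys

  record Structure : Set (suc ℓ) where
    field
      setoid         : Setoid ℓ ℓ
      interpretation : Interpretation setoid
    open Setoid setoid public
    open Interpretation interpretation public

module _ {L : Language ℓ} where

  module Semantics (M : Structure L) where
    open Structure M

    eval : ∀ {n} → Vector Carrier n → Term L n → Carrier
    eval ρ (var i)     = ρ i
    eval ρ (func g ts) = fun g (λ i → eval ρ (ts i))

    Sat : ∀ {n} → Vector Carrier n → Formula L n → Set ℓ
    Sat ρ false       = ⊥
    Sat ρ (equal s t) = eval ρ s ≈ eval ρ t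
    Sat ρ (reln R ts) = rel R (λ i → eval ρ (ts i))
    Sat ρ (and φ ψ)   = Sat ρ φ × Sat ρ ψ
    Sat ρ (or φ ψ)    = Sat ρ φ ⊎ Sat ρ ψ
    Sat ρ (imp φ ψ)   = Sat ρ φ → Sat ρ ψ
    Sat ρ (all φ)     = ∀ x → Sat (x ∷ ρ) φ
    Sat ρ (ex φ)      = ∃[ x ] Sat (x ∷ ρ) φ

    -- Definability with parameters b.
    Definable : ∀ {n} → Pred (Vector Carrier n) ℓ → Set ℓ
    Definable {n} P =
      Σ[ m ∈ ℕ ] Σ[ φ ∈ Formula L (n +ℕ m) ] Σ[ b ∈ Vector Carrier m ]
        (∀ a → P a ⇔ Sat (a ++ b) φ)

  ElementarilyEquivalent : Structure L → Structure L → Set ℓ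
  ElementarilyEquivalent M N =
    (φ : Formula L 0) → Semantics.Sat M [] φ ⇔ Semantics.Sat N [] φ

------------------------------------------------------------------------
-- Partial maps between setoids

record _⇀_ (A B : Setoid ℓ ℓ) : Set (suc ℓ) where
  private
    module A = Setoid A
    module B = Setoid B
  field
    dom      : Pred A.Carrier ℓ
    dom-resp : dom Respects A._≈_
    app      : ∀ x → x ∈ dom → B.Carrier
    app-cong : ∀ {x y} (p : x ∈ dom) (q : y ∈ dom) →
               x A.≈ y → app x p B.≈ app y q

  Graph : A.Carrier → B.Carrier → Set ℓ
  Graph x y = Σ[ p ∈ (x ∈ dom) ] (app x p B.≈ y)

  Image : Pred B.Carrier ℓ
  Image y = ∃[ x ] Graph x y

open _⇀_ public using (dom; app; Graph; Image)

module _ {A B : Setoid ℓ ℓ} where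
  open Setoid A using (Carrier; _≈_)

  restrict : A ⇀ B → (P : Pred Carrier ℓ) → P Respects _≈_ → A ⇀ B
  restrict f P P-resp = record
    { dom      = dom f ∩ P
    ; dom-resp = λ x≈y (p , q) → _⇀_.dom-resp f x≈y p , P-resp x≈y q
    ; app      = λ x p → app f x (proj₁ p)
    ; app-cong = λ p q → _⇀_.app-cong f (proj₁ p) (proj₁ q)
    }

  -- f|(X∖F), where X is the domain of f and F is listed without regard to
  -- order and repetitions.
  _∖_ : A ⇀ B → List Carrier → A ⇀ B
  f ∖ F = restrict f (λ x → x ∉ F) (ListMembershipₚ.∉-resp-≈ A {F})
    where open ListMembership A using (_∉_)

-- h_x = h(x,·).
section : ∀ {A B C : Setoid ℓ ℓ} → ×-setoid A B ⇀ C → Setoid.Carrier A → B ⇀ C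
section {A = A} h x = record
  { dom      = λ y → dom h (x , y)
  ; dom-resp = λ y≈y′ → _⇀_.dom-resp h (Setoid.refl A , y≈y′)
  ; app      = λ y → app h (x , y)
  ; app-cong = λ p q y≈y′ → _⇀_.app-cong h p q (Setoid.refl A , y≈y′)
  }

------------------------------------------------------------------------
-- Valued fields

record OrderedAbelianGroup ℓ : Set (suc ℓ) where
  field
    abelianGroup : AbelianGroup ℓ ℓ
  open AbelianGroup abelianGroup public
  field
    _≤_          : Rel Carrier ℓ
    isTotalOrder : IsTotalOrder _≈_ _≤_
    ∙-monoˡ-≤    : ∀ α {β γ} → β ≤ γ → (α ∙ β) ≤ (α ∙ γ)

  infix 4 _≤_

  open ToStrict _≈_ _≤_ public using (_<_)

  <-respʳ : _<_ Respectsʳ _≈_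
  <-respʳ = ToStrict.<-respʳ-≈ _≈_ _≤_ sym trans O.≤-respʳ-≈
    where module O = IsTotalOrder isTotalOrder

  open SupEq _≈_ public using (_≈⁺_)
  open SupNonStrict _≤_ public using (_≤⁺_)
  open SupStrict _<_ public using (_<⁺_; [_])

  _∙⁺_ : Carrier ⁺ → Carrier ⁺ → Carrier ⁺
  [ α ] ∙⁺ [ β ] = [ α ∙ β ]
  [ _ ] ∙⁺ ⊤⁺    = ⊤⁺
  ⊤⁺    ∙⁺ _     = ⊤⁺

record ValuedField ℓ : Set (suc ℓ) where
  field
    commutativeRing : CommutativeRing ℓ ℓ
    valueGroup      : OrderedAbelianGroup ℓ
  open CommutativeRing commutativeRing public
  module Γ = OrderedAbelianGroup valueGroup
  open Γ public using (_≈⁺_; _≤⁺_; _<⁺_)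
  field
    1≉0           : ¬ (1# ≈ 0#)
    inverse       : ∀ x → ¬ (x ≈ 0#) → ∃[ y ] (x * y ≈ 1#)
    v             : Carrier → Γ.Carrier ⁺
    v-cong        : ∀ {x y} → x ≈ y → v x ≈⁺ v y
    v-∞           : ∀ x → (v x ≈⁺ ⊤⁺) ⇔ (x ≈ 0#)
    v-*           : ∀ x y → v (x * y) ≈⁺ (v x Γ.∙⁺ v y)
    -- min (v x) (v y) ≤ v (x + y)
    v-+           : ∀ x y → (v x ≤⁺ v (x + y)) ⊎ (v y ≤⁺ v (x + y))
    v-surjective  : ∀ γ → ∃[ x ] (v x ≈⁺ [ γ ])
    v-nontrivial  : ∃[ x ] (¬ (x ≈ 0#) × ¬ (v x ≈⁺ [ Γ.ε ]))

  ≤⁺-resp-≈⁺ : ∀ {α α′ β β′} → α ≈⁺ α′ → β ≈⁺ β′ → α ≤⁺ β → α′ ≤⁺ β′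
  ≤⁺-resp-≈⁺ α≈ β≈ = P.≲-respˡ-≈ α≈ ∘ P.≲-respʳ-≈ β≈
    where module P = IsPreorder (SupNonStrict.≤⁺-isPreorder Γ._≤_
                       (IsTotalOrder.isPreorder Γ.isTotalOrder))

  <⁺-respʳ-≈⁺ : ∀ {α β β′} → β ≈⁺ β′ → α <⁺ β → α <⁺ β′
  <⁺-respʳ-≈⁺ = SupStrict.<⁺-respʳ-≈⁺ Γ._<_ Γ.<-respʳ

module _ (𝒦 : ValuedField ℓ) where
  open ValuedField 𝒦
  open RawSemiringDefs (Semiring.rawSemiring semiring) using (sum; _^_)

  -- c lists the coefficients of a polynomial of degree n + 1, constant term
  -- first.
  AlgebraicallyClosed : Set ℓ
  AlgebraicallyClosed =
    ∀ n (c : Vector Carrier (2 +ℕ n)) → ¬ (c (fromℕ (1+ n)) ≈ 0#) →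
    ∃[ x ] (sum (λ i → c i * x ^ toℕ i) ≈ 0#)

  -- A closed ball may have radius +∞ = ⊤⁺, an open ball radius -∞ = ⊥₋.
  ClosedBall : Carrier → Γ.Carrier ⁺ → Pred Carrier ℓ
  ClosedBall a γ x = γ ≤⁺ v (x - a)

  OpenBall : Carrier → Γ.Carrier ₋ → Pred Carrier ℓ
  OpenBall a ⊥₋    x = ⊤
  OpenBall a [ γ ] x = [ γ ] <⁺ v (x - a)

  OpenBall-resp : ∀ a γ → OpenBall a γ Respects _≈_
  OpenBall-resp a ⊥₋    x≈y x∈B = x∈B
  OpenBall-resp a [ γ ] x≈y     = <⁺-respʳ-≈⁺ (v-cong (+-congʳ x≈y))

  IsOpenBall : Pred Carrier ℓ → Set ℓ
  IsOpenBall P = ∃[ a ] ∃[ γ ] (P ≐ OpenBall a γ)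

  data BallExpr : Set ℓ where
    closed : Carrier → Γ.Carrier ⁺ → BallExpr
    open′  : Carrier → Γ.Carrier ₋ → BallExpr
    ∁′     : BallExpr → BallExpr
    _∩′_   : BallExpr → BallExpr → BallExpr
    _∪′_   : BallExpr → BallExpr → BallExpr

  ⟦_⟧ : BallExpr → Pred Carrier ℓ
  ⟦ closed a γ ⟧ = ClosedBall a γ
  ⟦ open′ a γ ⟧  = OpenBall a γ
  ⟦ ∁′ e ⟧       = ∁ ⟦ e ⟧
  ⟦ e ∩′ e′ ⟧    = ⟦ e ⟧ ∩ ⟦ e′ ⟧
  ⟦ e ∪′ e′ ⟧    = ⟦ e ⟧ ∪ ⟦ e′ ⟧

  IsBooleanCombinationOfBalls : Pred Carrier ℓ → Set ℓ
  IsBooleanCombinationOfBalls P = ∃[ e ] (P ≐ ⟦ e ⟧)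

  C : Carrier → Carrier → Carrier → Set ℓ
  C x y z = (v (x - y) ≈⁺ v (x - z)) × (v (x - z) <⁺ v (y - z))

  IsCIsomorphism : setoid ⇀ setoid → Set ℓ
  IsCIsomorphism f =
    IsOpenBall (dom f) × IsOpenBall (Image f) ×
    (∀ x y z (p : x ∈ dom f) (q : y ∈ dom f) (r : z ∈ dom f) →
       C x y z ⇔ C (app f x p) (app f y q) (app f z r))

  IsLocalCIsomorphism : setoid ⇀ setoid → Set ℓ
  IsLocalCIsomorphism f =
    ∀ x → x ∈ dom f →
    ∃[ a ] ∃[ γ ] (x ∈ OpenBall a γ × OpenBall a γ ⊆ dom f ×
                   IsCIsomorphism (restrict f (OpenBall a γ) (OpenBall-resp a γ)))

  FactorizesThrough : setoid ⇀ setoid → Γ.setoid ⇀ Γ.setoid → Set ℓ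
  FactorizesThrough f h =
    ∀ x y (p : x ∈ dom f) (q : y ∈ dom f) → ¬ (x ≈ y) →
    ∃[ γ ] Σ[ r ∈ (γ ∈ dom h) ]
      ((v (x - y) ≈⁺ [ γ ]) × (v (app f x p - app f y q) ≈⁺ [ app h γ r ]))

  -- The first conjunct says that h is a function Y ⊆ X × Γ → Γ.
  LocallyFactorizesThrough :
    setoid ⇀ setoid → ×-setoid setoid Γ.setoid ⇀ Γ.setoid → Set ℓ
  LocallyFactorizesThrough f h =
    (∀ x γ → (x , γ) ∈ dom h → x ∈ dom f) ×
    (∀ x → x ∈ dom f →
     ∃[ a ] ∃[ γ ] (x ∈ OpenBall a γ × OpenBall a γ ⊆ dom f ×
       FactorizesThrough (restrict f (OpenBall a γ) (OpenBall-resp a γ))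
                         (section h x)))

------------------------------------------------------------------------
-- Expansions of valued fields

data DivFunc {ℓ} : ℕ → Set ℓ where
  zeroᵈ oneᵈ : DivFunc 0
  negᵈ       : DivFunc 1
  addᵈ mulᵈ  : DivFunc 2

data DivReln {ℓ} : ℕ → Set ℓ where
  divᵈ : DivReln 2

L-div : Language ℓ
L-div = record { Func = DivFunc ; Reln = DivReln }

-- An expansion of (K, L-div) to the language L-div ⊕ E, E being the language
-- of the additional symbols.
record Expansion (E : Language ℓ) : Set (suc ℓ) where
  field
    valuedField : ValuedField ℓ
  open ValuedField valuedField public
  field
    extra : Interpretation E setoid
  private
    module E = Interpretation extra

  funᵈ : ∀ {k} → DivFunc {ℓ} k → Vector Carrier k → Carrier
  funᵈ zeroᵈ xs = 0#
  funᵈ oneᵈ  xs = 1#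
  funᵈ negᵈ  xs = - xs 0F
  funᵈ addᵈ  xs = xs 0F + xs 1F
  funᵈ mulᵈ  xs = xs 0F * xs 1F

  funᵈ-cong : ∀ {k} (g : DivFunc k) {xs ys : Vector Carrier k} →
              (∀ i → xs i ≈ ys i) → funᵈ g xs ≈ funᵈ g ys
  funᵈ-cong zeroᵈ xs≈ys = refl
  funᵈ-cong oneᵈ  xs≈ys = refl
  funᵈ-cong negᵈ  xs≈ys = -‿cong (xs≈ys 0F)
  funᵈ-cong addᵈ  xs≈ys = +-cong (xs≈ys 0F) (xs≈ys 1F)
  funᵈ-cong mulᵈ  xs≈ys = *-cong (xs≈ys 0F) (xs≈ys 1F)

  relᵈ : ∀ {k} → DivReln {ℓ} k → Vector Carrier k → Set ℓ
  relᵈ divᵈ xs = v (xs 0F) ≤⁺ v (xs 1F)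

  relᵈ-resp : ∀ {k} (R : DivReln k) {xs ys : Vector Carrier k} →
              (∀ i → xs i ≈ ys i) → relᵈ R xs → relᵈ R ys
  relᵈ-resp divᵈ xs≈ys = ≤⁺-resp-≈⁺ (v-cong (xs≈ys 0F)) (v-cong (xs≈ys 1F))

  structure : Structure (L-div ⊕ E)
  structure = record
    { setoid         = setoid
    ; interpretation = record
      { fun      = λ { (inj₁ g) → funᵈ g ; (inj₂ g) → E.fun g }
      ; fun-cong = λ { (inj₁ g) → funᵈ-cong g ; (inj₂ g) → E.fun-cong g }
      ; rel      = λ { (inj₁ R) → relᵈ R ; (inj₂ R) → E.rel R }
      ; rel-resp = λ { (inj₁ R) → relᵈ-resp R ; (inj₂ R) → E.rel-resp R }
      }
    }

  open Semantics structure public using (Definable)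

  -- Subsets of Kⁿ × Γᵐ are interpretable when their preimage in Kⁿ × (K^×)ᵐ
  -- under (id , v) is definable; Γ is here the imaginary sort K^×/O^×.
  Interpretable : ∀ {n m} → (Vector Carrier n → Vector Γ.Carrier m → Set ℓ) →
                  Set ℓ
  Interpretable {n} {m} R = Definable {n +ℕ m} λ a →
    ∃[ γ ] ((∀ i → v (drop n a i) ≈⁺ [ γ i ]) × R (take n a) γ)

  DefinableMap : setoid ⇀ setoid → Set ℓ
  DefinableMap f = Definable {2} λ a → Graph f (a 0F) (a 1F)

  DefinableFamily : ×-setoid setoid Γ.setoid ⇀ Γ.setoid → Set ℓ
  DefinableFamily h = Interpretable {1} {2} λ a γ → Graph h (a 0F , γ 0F) (γ 1F)

-- The axioms of non-trivially valued fields are first-order, so every model of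
-- the theory of 𝒦 is an expansion of a valued field and it is enough to range
-- over those.  Since every formula and every failure of the condition involves
-- only a set of symbols and parameters in Set ℓ, models in Set ℓ suffice
-- (Löwenheim–Skolem).
CMinimal : {E : Language ℓ} → Expansion E → Set (suc ℓ)
CMinimal {ℓ} {E} 𝒦 =
  AlgebraicallyClosed (Expansion.valuedField 𝒦) ×
  ((𝒦′ : Expansion E) → let open Expansion 𝒦′ in
   ElementarilyEquivalent structure (Expansion.structure 𝒦) →
   (P : Pred Carrier ℓ) → Definable {1} (λ a → P (a 0F)) →
   IsBooleanCombinationOfBalls valuedField P)

{-# OPTIONS --safe #-}

-- Near a point a local C-isomorphism f satisfies v (f x - f y) = h_x (v (x - y)), with h_x
-- depending on x.  Let D be the set of x round which no ball makes h_x independent of x.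
-- D is definable, so it is finite unless it contains a ball, in which case f is a
-- C-isomorphism on a neighbourhood of some closed ball b ⊆ D of radius δ.  Fix γ > δ.  For
-- each value g the set {y ∈ b : h_y(γ) < g} splits only finitely many of the open balls of
-- radius δ in b (the "classes").  A definable family, indexed by the value group, of finite
-- sets of classes has a finite union, because the value group is densely ordered and
-- o-minimal while an infinite definable set of classes is cofinite.  Hence y ↦ h_y(γ) is
-- constant on all but finitely many classes, and by the same principle, applied to the
-- exceptional classes as γ varies, some class is exceptional for no γ.  There f factorizes
-- over Γ, contradicting b ⊆ D.  Only definable subsets of K itself are used.

module Submission where

open import Defs
open import Axiom.ExcludedMiddle using (ExcludedMiddle)
open import Data.Empty using (⊥-elim)
open import Data.Fin.Base using (Fin; zero; suc; _↑ˡ_; _↑ʳ_; splitAt)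
open import Data.Fin.Patterns using (0F; 1F; 2F; 3F; 4F; 5F)
open import Data.List.Base using (List; []; _∷_; _++_; length; map)
open import Data.List.Membership.Propositional using () renaming (_∈_ to _∈ₗ_)
open import Data.List.Properties using (length-map)
open import Data.List.Relation.Unary.All as All using (All; []; _∷_)
open import Data.List.Relation.Unary.Any as Any using (Any; here; there)
open import Data.Nat.Base using (ℕ) renaming (suc to 1+_; _+_ to _+ℕ_)
open import Data.Product.Base as Prod using (Σ-syntax; ∃; ∃-syntax; _×_; _,_; proj₁; proj₂)
open import Data.Product.Relation.Binary.Pointwise.NonDependent using (×-setoid)
open import Data.Sum.Base as Sum using (_⊎_; inj₁; inj₂; [_,_]′)
open import Data.Unit.Polymorphic.Base using (⊤; tt)
open import Data.Vec.Functional using (Vector) renaming ([] to []ᵛ; _∷_ to _∷ᵛ_; _++_ to _++ᵛ_)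
open import Data.Vec.Functional.Properties using (lookup-++ˡ; lookup-++ʳ)
open import Function.Base using (_∘_; id)
open import Function.Bundles using (_⇔_; mk⇔; Equivalence)
open import Relation.Binary.PropositionalEquality.Core as ≡ using (_≡_)
open import Relation.Binary.Structures using (IsTotalOrder)
open import Relation.Nullary using (¬_; yes; no)
open import Relation.Nullary.Construct.Add.Infimum using (⊥₋)
open import Relation.Nullary.Construct.Add.Supremum using (⊤⁺; [_])
open import Relation.Nullary.Decidable using (decidable-stable)
open import Relation.Unary using (Pred; _⊆_; _≐_; _∩_; _∪_; ∁)
import Algebra.Properties.AbelianGroup as AbelianGroupProperties
import Algebra.Properties.Ring as RingProperties
import Data.List.Relation.Unary.All.Properties as Allₚ
import Data.List.Relation.Unary.Any.Properties as Anyₚ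
import Data.Nat.Properties as ℕₚ
import Level
import Relation.Binary.Construct.Add.Supremum.Equality as SupEq
import Relation.Binary.Construct.Add.Supremum.NonStrict as SupNonStrict
import Relation.Binary.Construct.Add.Supremum.Strict as SupStrict
import Relation.Binary.Reasoning.Setoid as ≈-Reasoning

-- This shortens a finite cover by one element. The last clause holds for every `Q`, so one deletion
-- serves all later queries about the list.
remove : ∀ {a p q} {A : Set a} {P : A → Set p} {xs : List A} → Any P xs →
         Σ[ x ∈ A ] Σ[ ys ∈ List A ] (P x × length xs ≡ 1+ (length ys) ×
           ({Q : A → Set q} → Any Q xs → Q x ⊎ Any Q ys))
remove (here {x} {xs} px) = x , xs , px , ≡.refl ,
  λ { (here qx) → inj₁ qx ; (there q) → inj₂ q }
remove (there {y} {xs} p) with remove p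
... | x , ys , px , eq , sep = x , y ∷ ys , px , ≡.cong 1+_ eq ,
  λ { (here qy) → inj₂ (here qy)
    ; (there q) → [ inj₁ , inj₂ ∘ there ]′ (sep q) }

-- The order x ≼ y :⇔ v x ≤ v y on K

module ValuationOrder {ℓ} (em : ExcludedMiddle ℓ) (𝒱 : ValuedField ℓ) where
  open ValuedField 𝒱
  open RingProperties ring
  open IsTotalOrder Γ.isTotalOrder using (isPreorder; antisym; total)
    renaming (reflexive to ≤-reflexive; trans to ≤-trans)
  open ≈-Reasoning setoid

  infix 4 _≼_ _≺_ _∼_

  -- Values are represented by field elements, with `0#` standing for infinity, so that sets of
  -- values become subsets of K. By totality the negated reverse order is the strict order of
  -- values.
  _≼_ _≺_ _∼_ : Carrier → Carrier → Set ℓ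
  x ≼ y = v x ≤⁺ v y
  x ≺ y = ¬ (y ≼ x)
  x ∼ y = (x ≼ y) × (y ≼ x)

  stable : {P : Set ℓ} → ¬ ¬ P → P
  stable = decidable-stable em

  ≼-reflexive : ∀ {x y} → x ≈ y → x ≼ y
  ≼-reflexive x≈y = SupNonStrict.≤⁺-reflexive _ ≤-reflexive (v-cong x≈y)

  ≼-refl : ∀ {x} → x ≼ x
  ≼-refl = ≼-reflexive refl

  ≼-trans : ∀ {x y z} → x ≼ y → y ≼ z → x ≼ z
  ≼-trans = SupNonStrict.≤⁺-trans _ ≤-trans

  ≼-total : ∀ x y → x ≼ y ⊎ y ≼ x
  ≼-total x y = SupNonStrict.≤⁺-total _ total (v x) (v y)

  ≼-resp : ∀ {x x′ y y′} → x ≈ x′ → y ≈ y′ → x ≼ y → x′ ≼ y′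
  ≼-resp x≈ y≈ = ≤⁺-resp-≈⁺ (v-cong x≈) (v-cong y≈)

  ≼-respʳ : ∀ {x y y′} → y ≈ y′ → x ≼ y → x ≼ y′
  ≼-respʳ = ≼-resp refl

  ≼-respˡ : ∀ {x x′ y} → x ≈ x′ → x ≼ y → x′ ≼ y
  ≼-respˡ x≈ = ≼-resp x≈ refl

  ≺-resp : ∀ {x x′ y y′} → x ≈ x′ → y ≈ y′ → x ≺ y → x′ ≺ y′
  ≺-resp x≈ y≈ x≺y y′≼x′ = x≺y (≼-resp (sym y≈) (sym x≈) y′≼x′)

  ≺-respʳ : ∀ {x y y′} → y ≈ y′ → x ≺ y → x ≺ y′
  ≺-respʳ = ≺-resp refl

  ≺⇒≼ : ∀ {x y} → x ≺ y → x ≼ y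
  ≺⇒≼ {x} {y} x≺y with ≼-total x y
  ... | inj₁ x≼y = x≼y
  ... | inj₂ y≼x = ⊥-elim (x≺y y≼x)

  ≼≺-trans : ∀ {x y z} → x ≼ y → y ≺ z → x ≺ z
  ≼≺-trans x≼y y≺z z≼x = y≺z (≼-trans z≼x x≼y)

  ≺≼-trans : ∀ {x y z} → x ≺ y → y ≼ z → x ≺ z
  ≺≼-trans x≺y y≼z z≼x = x≺y (≼-trans y≼z z≼x)

  ≺-trans : ∀ {x y z} → x ≺ y → y ≺ z → x ≺ z
  ≺-trans x≺y = ≼≺-trans (≺⇒≼ x≺y)

  ≺-irrefl : ∀ {x} → ¬ (x ≺ x)
  ≺-irrefl x≺x = x≺x ≼-refl

  compare : ∀ x y → x ≼ y ⊎ y ≺ x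
  compare x y with em {x ≼ y}
  ... | yes p = inj₁ p
  ... | no  p = inj₂ p

  ∼-sym : ∀ {x y} → x ∼ y → y ∼ x
  ∼-sym (p , q) = q , p

  ∼-trans : ∀ {x y z} → x ∼ y → y ∼ z → x ∼ z
  ∼-trans (p , q) (p′ , q′) = ≼-trans p p′ , ≼-trans q′ q

  ∼-reflexive : ∀ {x y} → x ≈ y → x ∼ y
  ∼-reflexive x≈y = ≼-reflexive x≈y , ≼-reflexive (sym x≈y)

  ∼⇒≈⁺ : ∀ {x y} → x ∼ y → v x ≈⁺ v y
  ∼⇒≈⁺ (p , q) = SupNonStrict.≤⁺-antisym _ antisym p q

  ≈⁺⇒≤⁺ : ∀ {α β} → α ≈⁺ β → α ≤⁺ β
  ≈⁺⇒≤⁺ = SupNonStrict.≤⁺-reflexive _ ≤-reflexive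

  ≈⁺-sym : ∀ {α β} → α ≈⁺ β → β ≈⁺ α
  ≈⁺-sym = SupEq.≈⁺-sym _ Γ.sym

  ≈⁺-trans : ∀ {α β γ} → α ≈⁺ β → β ≈⁺ γ → α ≈⁺ γ
  ≈⁺-trans = SupEq.≈⁺-trans _ Γ.trans

  ≤⁺-trans : ∀ {α β γ} → α ≤⁺ β → β ≤⁺ γ → α ≤⁺ γ
  ≤⁺-trans = SupNonStrict.≤⁺-trans _ ≤-trans

  ≈⁺⇒∼ : ∀ {x y} → v x ≈⁺ v y → x ∼ y
  ≈⁺⇒∼ p = ≈⁺⇒≤⁺ p , ≈⁺⇒≤⁺ (≈⁺-sym p)

  <⁺⇒≱⁺ : ∀ {α β} → α <⁺ β → ¬ (β ≤⁺ α)
  <⁺⇒≱⁺ SupStrict.[ (p , ¬p) ] SupNonStrict.[ q ] = ¬p (antisym p q)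
  <⁺⇒≱⁺ SupStrict.[ _ ]<⊤⁺ ()

  ≱⁺⇒<⁺ : ∀ {α β} → ¬ (β ≤⁺ α) → α <⁺ β
  ≱⁺⇒<⁺ {[ α ]} {[ β ]} p with total α β
  ... | inj₁ α≤β = SupStrict.[ (α≤β , λ α≈β → p SupNonStrict.[ ≤-reflexive (Γ.sym α≈β) ]) ]
  ... | inj₂ β≤α = ⊥-elim (p SupNonStrict.[ β≤α ])
  ≱⁺⇒<⁺ {[ α ]} {⊤⁺}    p = SupStrict.[ α ]<⊤⁺
  ≱⁺⇒<⁺ {⊤⁺}    {β}     p = ⊥-elim (p (β SupNonStrict.≤⊤⁺))

  x≼0 : ∀ {x} → x ≼ 0#
  x≼0 = ≤⁺-trans (_ SupNonStrict.≤⊤⁺)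
    (≈⁺⇒≤⁺ (≈⁺-sym (Equivalence.from (v-∞ 0#) refl)))

  0≼⇒≈0 : ∀ {x} → 0# ≼ x → x ≈ 0#
  0≼⇒≈0 0≼x = Equivalence.to (v-∞ _)
    (≈⁺-trans (∼⇒≈⁺ (x≼0 , 0≼x)) (Equivalence.from (v-∞ 0#) refl))

  ≉0⇒≺0 : ∀ {x} → ¬ (x ≈ 0#) → x ≺ 0#
  ≉0⇒≺0 x≉0 = x≉0 ∘ 0≼⇒≈0

  ≺⇒≉0 : ∀ {x y} → x ≺ y → ¬ (x ≈ 0#)
  ≺⇒≉0 x≺y x≈0 = x≺y (≼-resp refl (sym x≈0) x≼0)

  finite-value : ∀ {x} → ¬ (x ≈ 0#) → ∃[ γ ] (v x ≈⁺ [ γ ])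
  finite-value {x} x≉0 with v x in eq
  ... | [ γ ] = γ , SupEq.≈⁺-refl _ Γ.refl
  ... | ⊤⁺    = ⊥-elim (x≉0 (Equivalence.to (v-∞ x)
                  (≡.subst (_≈⁺ ⊤⁺) (≡.sym eq) (SupEq.≈⁺-refl _ Γ.refl))))

  finite-value⇒≉0 : ∀ {x γ} → v x ≈⁺ [ γ ] → ¬ (x ≈ 0#)
  finite-value⇒≉0 vx≈γ x≈0
    with ≈⁺-trans (≈⁺-sym vx≈γ) (Equivalence.from (v-∞ _) x≈0)
  ... | ()

  ∙⁺-mono : ∀ α {β γ} → β ≤⁺ γ → (α Γ.∙⁺ β) ≤⁺ (α Γ.∙⁺ γ)
  ∙⁺-mono [ α ] SupNonStrict.[ p ]      = SupNonStrict.[ Γ.∙-monoˡ-≤ α p ]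
  ∙⁺-mono [ α ] (β SupNonStrict.≤⊤⁺) = _ SupNonStrict.≤⊤⁺
  ∙⁺-mono ⊤⁺    p           = _ SupNonStrict.≤⊤⁺

  *-monoʳ-≼ : ∀ z {x y} → x ≼ y → z * x ≼ z * y
  *-monoʳ-≼ z p = ≤⁺-resp-≈⁺ (≈⁺-sym (v-* z _)) (≈⁺-sym (v-* z _)) (∙⁺-mono (v z) p)

  *-monoˡ-≼ : ∀ z {x y} → x ≼ y → x * z ≼ y * z
  *-monoˡ-≼ z p = ≼-resp (*-comm z _) (*-comm z _) (*-monoʳ-≼ z p)

  inverse-cancel : ∀ {z z⁻¹} x → z * z⁻¹ ≈ 1# → z⁻¹ * (z * x) ≈ x
  inverse-cancel {z} {z⁻¹} x zz⁻¹≈1 = begin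
    z⁻¹ * (z * x)  ≈⟨ *-assoc _ _ _ ⟨
    z⁻¹ * z * x    ≈⟨ *-congʳ (trans (*-comm _ _) zz⁻¹≈1) ⟩
    1# * x         ≈⟨ *-identityˡ x ⟩
    x              ∎

  *-cancelˡ-≼ : ∀ {z x y} → ¬ (z ≈ 0#) → z * x ≼ z * y → x ≼ y
  *-cancelˡ-≼ z≉0 p with z⁻¹ , zz⁻¹≈1 ← inverse _ z≉0 =
    ≼-resp (inverse-cancel _ zz⁻¹≈1) (inverse-cancel _ zz⁻¹≈1) (*-monoʳ-≼ z⁻¹ p)

  *-monoʳ-≺ : ∀ {z x y} → ¬ (z ≈ 0#) → x ≺ y → z * x ≺ z * y
  *-monoʳ-≺ z≉0 x≺y = x≺y ∘ *-cancelˡ-≼ z≉0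

  -- By totality only the case `- x ≼ x` remains, and multiplying it by `- 1#` gives the claim.
  x≼-x : ∀ x → x ≼ - x
  x≼-x x with ≼-total x (- x)
  ... | inj₁ p = p
  ... | inj₂ p = ≼-resp (trans (-1*x≈-x (- x)) (-‿involutive x)) (-1*x≈-x x) (*-monoʳ-≼ (- 1#) p)

  +-≼ : ∀ {g x y} → g ≼ x → g ≼ y → g ≼ x + y
  +-≼ {x = x} {y} g≼x g≼y = [ ≼-trans g≼x , ≼-trans g≼y ]′ (v-+ x y)

  +-≺ : ∀ {g x y} → g ≺ x → g ≺ y → g ≺ x + y
  +-≺ {x = x} {y} g≺x g≺y = [ ≺≼-trans g≺x , ≺≼-trans g≺y ]′ (v-+ x y)

  telescope : ∀ x y z → (x - y) + (y - z) ≈ x - z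
  telescope x y z = begin
    (x - y) + (y - z)    ≈⟨ +-assoc _ _ _ ⟩
    x + (- y + (y - z))  ≈⟨ +-congˡ (\\-leftDividesʳ y (- z)) ⟩
    x - z                ∎

  x+[y-x]≈y : ∀ x y → x + (y - x) ≈ y
  x+[y-x]≈y x y = trans (+-comm x _) (//-rightDividesˡ x y)

  [x+y]-x≈y : ∀ x y → (x + y) - x ≈ y
  [x+y]-x≈y = xyx⁻¹≈y

  Δ-sym : ∀ x y → x - y ∼ y - x
  Δ-sym x y = ≼-respʳ (⁻¹-anti-homo‿- x y) (x≼-x _) ,
              ≼-respʳ (⁻¹-anti-homo‿- y x) (x≼-x _)

  +-cancel-Δʳ : ∀ x y z → (x + z) - (y + z) ≈ x - y
  +-cancel-Δʳ x y z = begin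
    (x + z) - (y + z)      ≈⟨ +-congˡ (-‿anti-homo-+ y z) ⟩
    (x + z) + (- z - y)    ≈⟨ +-assoc _ _ _ ⟩
    x + (z + (- z - y))    ≈⟨ +-congˡ (\\-leftDividesˡ z (- y)) ⟩
    x - y                  ∎

  +-cancel-Δˡ : ∀ x y z → (z + x) - (z + y) ≈ x - y
  +-cancel-Δˡ x y z = trans (+-cong (+-comm z x) (-‿cong (+-comm z y))) (+-cancel-Δʳ x y z)

  flip-≼ : ∀ {g x y} → g ≼ x - y → g ≼ y - x
  flip-≼ p = ≼-trans p (proj₁ (Δ-sym _ _))

  flip-≺ : ∀ {g x y} → g ≺ x - y → g ≺ y - x
  flip-≺ p = ≺≼-trans p (proj₁ (Δ-sym _ _))

  Δ-≼ : ∀ {g x y z} → g ≼ x - y → g ≼ y - z → g ≼ x - z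
  Δ-≼ p q = ≼-respʳ (telescope _ _ _) (+-≼ p q)

  Δ-≺ : ∀ {g x y z} → g ≺ x - y → g ≺ y - z → g ≺ x - z
  Δ-≺ p q = ≺-respʳ (telescope _ _ _) (+-≺ p q)

  isosceles : ∀ {x y z} → x - y ≺ y - z → x - z ∼ x - y
  isosceles {x} {y} {z} p =
    stable (λ x-y≺x-z → ≺-irrefl (Δ-≺ x-y≺x-z (flip-≺ p))) ,
    Δ-≼ ≼-refl (≺⇒≼ p)

  far : ∀ {x a} → x ≺ a → x - a ∼ x
  far {x} {a} x≺a = ∼-trans
    (isosceles {x} {0#} {a} (≺-resp (sym (x-0≈x x)) refl (flip-≺ (≺-respʳ (sym (x-0≈x a)) x≺a))))
    (∼-reflexive (x-0≈x x))
    where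
    x-0≈x : ∀ x → x - 0# ≈ x
    x-0≈x x = trans (+-congˡ -0#≈0#) (+-identityʳ x)

  near-center : ∀ {x a} → a ≺ x → x - a ∼ a
  near-center {x} {a} a≺x = ∼-trans (Δ-sym x a) (far a≺x)

  -- An element of nonzero finite value or its inverse has positive value.
  positive : ∃[ t ] (¬ (t ≈ 0#) × 1# ≺ t)
  positive with x , x≉0 , vx≉ε ← v-nontrivial with compare 1# x | compare x 1#
  ... | inj₂ x≺1 | _ with x⁻¹ , xx⁻¹≈1 ← inverse x x≉0 =
          x⁻¹ ,
          (λ x⁻¹≈0 → 1≉0 (trans (sym xx⁻¹≈1) (trans (*-congˡ x⁻¹≈0) (zeroʳ x)))) ,
          λ x⁻¹≼1 → x≺1 (≼-resp xx⁻¹≈1 (*-identityʳ x) (*-monoʳ-≼ x x⁻¹≼1))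
  ... | inj₁ _   | inj₂ 1≺x = x , x≉0 , 1≺x
  ... | inj₁ 1≼x | inj₁ x≼1 = ⊥-elim (vx≉ε (≈⁺-trans (∼⇒≈⁺ (x≼1 , 1≼x)) v1≈ε))
    where
    -- A group has no idempotent but its identity; this is applied to the value of 1 = 1 · 1.
    idem⇒ε : ∀ {α} → α ≈⁺ (α Γ.∙⁺ α) → ¬ (α ≈⁺ ⊤⁺) → α ≈⁺ [ Γ.ε ]
    idem⇒ε {[ α ]} SupEq.[ p ] _ = SupEq.[ Γₚ.identityˡ-unique α α (Γ.sym p) ]
      where module Γₚ = AbelianGroupProperties Γ.abelianGroup
    idem⇒ε {⊤⁺} _ q = ⊥-elim (q SupEq.⊤⁺≈⊤⁺)
    v1≈ε : v 1# ≈⁺ [ Γ.ε ]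
    v1≈ε = idem⇒ε (≈⁺-trans (v-cong (sym (*-identityˡ 1#))) (v-* 1# 1#))
                   (1≉0 ∘ Equivalence.to (v-∞ 1#))

-- Density of the value group and infinitude of the residue field

module AlgebraicallyClosedValuation {ℓ} (em : ExcludedMiddle ℓ) (𝒱 : ValuedField ℓ)
                                    (closed : AlgebraicallyClosed 𝒱) where
  open ValuedField 𝒱
  open RingProperties ring
  open ValuationOrder em 𝒱
  open ≈-Reasoning setoid

  quadratic-root : ∀ p q → ∃[ x ] (x * x + p * x ≈ q)
  -- The argument 1 of `closed` means degree 2; the polynomial is X² + pX - q.
  quadratic-root p q with x , eq ← closed 1 (- q ∷ᵛ p ∷ᵛ 1# ∷ᵛ []ᵛ) 1≉0 = x , (begin
    x * x + p * x
      ≈⟨ +-comm _ _ ⟩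
    p * x + x * x
      ≈⟨ +-cong (*-congˡ (*-identityʳ x)) (trans (+-identityʳ _) (trans (*-identityˡ _) (*-congˡ (*-identityʳ x)))) ⟨
    p * (x * 1#) + (1# * (x * (x * 1#)) + 0#)
      ≈⟨ +-inverseʳ-unique _ _ eq ⟩
    - (- q * 1#)
      ≈⟨ trans (-‿cong (*-identityʳ (- q))) (-‿involutive q) ⟩
    q ∎)

  -- A square root of `x * y` has the midpoint of the two values. If `y` is zero, `x * t` with `t`
  -- of positive finite value lies in between.
  dense : ∀ {x y} → x ≺ y → ∃[ m ] (x ≺ m × m ≺ y)
  dense {x} {y} x≺y with em {y ≈ 0#}
  ... | yes y≈0 with t , t≉0 , 1≺t ← positive =
          x * t ,
          ≺-resp (*-identityʳ x) refl (*-monoʳ-≺ x≉0 1≺t) ,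
          ≺-resp refl (trans (zeroʳ x) (sym y≈0)) (*-monoʳ-≺ x≉0 (≉0⇒≺0 t≉0))
    where x≉0 = ≺⇒≉0 x≺y
  ... | no y≉0 with m , eq ← quadratic-root 0# (x * y) =
          m ,
          (λ m≼x → x≺y (*-cancelˡ-≼ (≺⇒≉0 x≺y) (≼-respˡ m²≈xy
            (≼-trans (*-monoʳ-≼ m m≼x) (*-monoˡ-≼ x m≼x))))) ,
          (λ y≼m → x≺y (*-cancelˡ-≼ y≉0 (≼-resp refl (trans m²≈xy (*-comm x y))
            (≼-trans (*-monoʳ-≼ y y≼m) (*-monoˡ-≼ m y≼m)))))
    where
    m²≈xy : m * m ≈ x * y
    m²≈xy = trans (sym (trans (+-congˡ (zeroˡ m)) (+-identityʳ _))) eq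

  -- φ descends to a surjective map of the residue field which identifies the
  -- classes of 0 and - 1, so any finite cover of the valuation ring by residue
  -- classes shrinks.
  private
    φ : Carrier → Carrier
    φ x = x * x + 1# * x

    scale-≺ : ∀ {g x z} → 1# ≼ z → g ≺ x → g ≺ z * x
    scale-≺ {x = x} 1≼z g≺x = ≺≼-trans g≺x (≼-respˡ (*-identityˡ x) (*-monoˡ-≼ x 1≼z))

    φ-near : ∀ {x y} → 1# ≼ x → 1# ≼ y → 1# ≺ x - y → 1# ≺ φ x - φ y
    φ-near {x} {y} 1≼x 1≼y 1≺x-y = Δ-≺
      (≺-respʳ (sym (+-cancel-Δʳ _ _ _)) (Δ-≺
        (≺-respʳ (x[y-z]≈xy-xz x x y) (scale-≺ 1≼x 1≺x-y))
        (≺-respʳ (trans (x[y-z]≈xy-xz y x y) (+-congʳ (*-comm y x))) (scale-≺ 1≼y 1≺x-y))))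
      (≺-respʳ (sym (trans (+-cancel-Δˡ _ _ _) (sym (x[y-z]≈xy-xz 1# x y)))) (scale-≺ ≼-refl 1≺x-y))

    -- If v(y) were negative, y² = φ(y) - y would have value at least v(y), although 2v(y) < v(y).
    φ-root-integral : ∀ {y} → 1# ≼ φ y → 1# ≼ y
    φ-root-integral {y} 1≼φy with compare 1# y
    ... | inj₁ 1≼y = 1≼y
    ... | inj₂ y≺1 = ⊥-elim (≺-resp refl (*-identityʳ y) (*-monoʳ-≺ (≺⇒≉0 y≺1) y≺1)
      (≼-respʳ (//-rightDividesʳ (1# * y) (y * y))
        (+-≼ (≼-trans (≺⇒≼ y≺1) 1≼φy) (≼-trans (≼-reflexive (sym (*-identityˡ y))) (x≼-x _)))))

    no-integral-cover : ∀ n F → length F ≡ n →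
                        ¬ (∀ z → 1# ≼ z → Any (λ x → 1# ≺ z - x) F)
    no-integral-cover 0 [] _ cover with () ← cover 0# x≼0
    no-integral-cover (1+ n) F |F|≡1+n cover
      with x′ , F′ , -1-near-x′ , |F|≡1+|F′| , sep ← remove (cover (- 1#) (x≼-x 1#)) =
        no-integral-cover n (map φ F′)
          (≡.trans (length-map φ F′) (ℕₚ.suc-injective (≡.trans (≡.sym |F|≡1+|F′|) |F|≡1+n)))
          shrunk
      where

      integral : ∀ {y x} → 1# ≼ y → 1# ≺ y - x → 1# ≼ x
      integral 1≼y 1≺y-x = ≼-respʳ (x+[y-x]≈y _ _) (+-≼ 1≼y (flip-≼ (≺⇒≼ 1≺y-x)))
      covered : ∀ {y z} → φ y ≈ z → 1# ≼ y → Any (λ x → 1# ≺ y - x) F′ →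
                Any (λ x → 1# ≺ z - x) (map φ F′)
      covered φy≈z 1≼y = Anyₚ.map⁺ ∘ Any.map (λ near →
        ≺-respʳ (+-congʳ φy≈z) (φ-near 1≼y (integral 1≼y near) near))
      φ[0]≈0 : φ 0# ≈ 0#
      φ[0]≈0 = trans (+-cong (zeroˡ 0#) (zeroʳ 1#)) (+-identityʳ 0#)
      φ[-1]≈0 : φ (- 1#) ≈ 0#
      φ[-1]≈0 = trans (+-cong (trans (-1*x≈-x (- 1#)) (-‿involutive 1#)) (*-identityˡ _)) (-‿inverseʳ 1#)
      0-covered : Any (λ x → 1# ≺ 0# - x) F′
      0-covered with sep (cover 0# x≼0)
      ... | inj₂ q = q
      ... | inj₁ 1≺0-x′ = ⊥-elim (Δ-≺ 1≺0-x′ (flip-≺ -1-near-x′)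
              (≼-reflexive (trans (+-identityˡ _) (-‿involutive 1#))))
      shrunk : ∀ z → 1# ≼ z → Any (λ x → 1# ≺ z - x) (map φ F′)
      shrunk z 1≼z with y , φy≈z ← quadratic-root 1# z
        with 1≼y ← φ-root-integral (≼-respʳ (sym φy≈z) 1≼z)
        with sep (cover y 1≼y)
      ... | inj₂ q = covered φy≈z 1≼y q
      -- Here `y` lies in the discarded class, that of `- 1#`. So `z` has the residue of φ(-1) =
      -- φ(0), and the class of `0#` is still covered by `F′`.
      ... | inj₁ 1≺y-x′ = Any.map
              (λ near → Δ-≺ (≺-respʳ (+-cong φy≈z (-‿cong φ[-1]≈0))
                (φ-near 1≼y (x≼-x 1#) (Δ-≺ 1≺y-x′ (flip-≺ -1-near-x′)))) near)
              (covered φ[0]≈0 x≼0 0-covered)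

  -- The substitution y = x₀ + dz turns the open balls of radius `d` in the closed ball into residue
  -- classes of the valuation ring.
  no-finite-cover : ∀ {x₀ d} F → ¬ (d ≈ 0#) →
                    ¬ (∀ y → d ≼ y - x₀ → Any (λ x → d ≺ y - x) F)
  no-finite-cover {x₀} {d} F d≉0 cover with d⁻¹ , dd⁻¹≈1 ← inverse d d≉0 =
    no-integral-cover _ (map ψ F) ≡.refl λ z 1≼z → Anyₚ.map⁺ (Any.map
      (λ {x} d≺ w → d≺ (≼-resp (difference z x) (*-identityʳ d) (*-monoʳ-≼ d w)))
      (cover (x₀ + d * z)
        (≼-resp (*-identityʳ d) (sym ([x+y]-x≈y x₀ _)) (*-monoʳ-≼ d 1≼z))))
    where
    ψ : Carrier → Carrier
    ψ x = d⁻¹ * (x - x₀)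
    difference : ∀ z x → d * (z - ψ x) ≈ (x₀ + d * z) - x
    difference z x = begin
      d * (z - ψ x)                    ≈⟨ x[y-z]≈xy-xz d z (ψ x) ⟩
      d * z - d * ψ x                  ≈⟨ +-cong (sym ([x+y]-x≈y x₀ _)) (-‿cong (inverse-cancel _ (trans (*-comm _ _) dd⁻¹≈1))) ⟩
      (x₀ + d * z) - x₀ - (x - x₀)     ≈⟨ +-congˡ (⁻¹-anti-homo‿- x x₀) ⟩
      (x₀ + d * z) - x₀ + (x₀ - x)     ≈⟨ telescope _ _ _ ⟩
      (x₀ + d * z) - x ∎

-- Definable sets with parameters

extend : ∀ {n k} → (Fin n → Fin k) → Fin (1+ n) → Fin (1+ k)
extend σ zero    = zero
extend σ (suc i) = suc (σ i)

module _ {ℓ} {L : Language ℓ} where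

  renameTerm : ∀ {n k} → (Fin n → Fin k) → Term L n → Term L k
  renameTerm σ (var i)     = var (σ i)
  renameTerm σ (func g ts) = func g (λ i → renameTerm σ (ts i))

  rename : ∀ {n k} → (Fin n → Fin k) → Formula L n → Formula L k
  rename σ false       = false
  rename σ (equal s t) = equal (renameTerm σ s) (renameTerm σ t)
  rename σ (reln R ts) = reln R (λ i → renameTerm σ (ts i))
  rename σ (and φ ψ)   = and (rename σ φ) (rename σ ψ)
  rename σ (or φ ψ)    = or (rename σ φ) (rename σ ψ)
  rename σ (imp φ ψ)   = imp (rename σ φ) (rename σ ψ)
  rename σ (all φ)     = all (rename (extend σ) φ)
  rename σ (ex φ)      = ex (rename (extend σ) φ)

  module Renaming (M : Structure L) where
    open Structure M
    open Semantics M

    eval-rename : ∀ {n k} (σ : Fin n → Fin k) {ρ : Vector Carrier n} {ρ′ : Vector Carrier k} →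
                  (∀ i → ρ′ (σ i) ≈ ρ i) →
                  (t : Term L n) → eval ρ′ (renameTerm σ t) ≈ eval ρ t
    eval-rename σ eq (var i)     = eq i
    eval-rename σ eq (func g ts) = fun-cong g (λ i → eval-rename σ eq (ts i))

    extend-eq : ∀ {n k} (σ : Fin n → Fin k) {ρ : Vector Carrier n} {ρ′ : Vector Carrier k} →
              (∀ i → ρ′ (σ i) ≈ ρ i) →
              ∀ x i → (x ∷ᵛ ρ′) (extend σ i) ≈ (x ∷ᵛ ρ) i
    extend-eq σ eq x zero    = refl
    extend-eq σ eq x (suc i) = eq i

    -- Agreement is asked only pointwise up to `_≈_`, so that with `σ` the identity truth also
    -- passes between `x ∷ᵛ (a ++ᵛ b)` and `(x ∷ᵛ a) ++ᵛ b`.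
    Sat-rename : ∀ {n k} (σ : Fin n → Fin k) {ρ : Vector Carrier n} {ρ′ : Vector Carrier k} →
                 (∀ i → ρ′ (σ i) ≈ ρ i) →
                 (φ : Formula L n) → Sat ρ′ (rename σ φ) ⇔ Sat ρ φ
    Sat-rename σ eq false = mk⇔ id id
    Sat-rename σ eq (equal s t) = mk⇔
      (λ p → trans (sym (eval-rename σ eq s)) (trans p (eval-rename σ eq t)))
      (λ p → trans (eval-rename σ eq s) (trans p (sym (eval-rename σ eq t))))
    Sat-rename σ eq (reln R ts) = mk⇔
      (rel-resp R (λ i → eval-rename σ eq (ts i)))
      (rel-resp R (λ i → sym (eval-rename σ eq (ts i))))
    Sat-rename σ eq (and φ ψ) = mk⇔
      (Prod.map (to (Sat-rename σ eq φ)) (to (Sat-rename σ eq ψ)))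
      (Prod.map (from (Sat-rename σ eq φ)) (from (Sat-rename σ eq ψ)))
      where open Equivalence
    Sat-rename σ eq (or φ ψ) = mk⇔
      (Sum.map (to (Sat-rename σ eq φ)) (to (Sat-rename σ eq ψ)))
      (Sum.map (from (Sat-rename σ eq φ)) (from (Sat-rename σ eq ψ)))
      where open Equivalence
    Sat-rename σ eq (imp φ ψ) = mk⇔
      (λ h → to (Sat-rename σ eq ψ) ∘ h ∘ from (Sat-rename σ eq φ))
      (λ h → from (Sat-rename σ eq ψ) ∘ h ∘ to (Sat-rename σ eq φ))
      where open Equivalence
    Sat-rename σ eq (all φ) = mk⇔
      (λ h x → to (Sat-rename (extend σ) (extend-eq σ eq x) φ) (h x))
      (λ h x → from (Sat-rename (extend σ) (extend-eq σ eq x) φ) (h x))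
      where open Equivalence
    Sat-rename σ eq (ex φ) = mk⇔
      (λ (x , h) → x , to (Sat-rename (extend σ) (extend-eq σ eq x) φ) h)
      (λ (x , h) → x , from (Sat-rename (extend σ) (extend-eq σ eq x) φ) h)
      where open Equivalence

-- Closure properties of definable sets and functions

module DefinableSets {ℓ} {E : Language ℓ} (𝒦 : Expansion E) where
  open Expansion 𝒦 hiding (zero)
  open Semantics structure using (Sat; eval)
  open Renaming structure
  open Equivalence

  private
    variable
      n k : ℕ
      P Q : Pred (Vector Carrier n) ℓ

  -- A record, so that P can be inferred from Dfn P.
  record Dfn {n} (P : Pred (Vector Carrier n) ℓ) : Set ℓ where
    constructor dfn
    field
      definable : Definable P
  open Dfn public

  record DFun {n} (t : Vector Carrier n → Carrier) : Set ℓ where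
    constructor dfun
    field
      graph : Dfn {1+ n} λ a → a zero ≈ t (a ∘ suc)
  open DFun public

  Dfn₁ : Pred Carrier ℓ → Set ℓ
  Dfn₁ P = Dfn {1} λ a → P (a 0F)

  Dfn₂ : (Carrier → Carrier → Set ℓ) → Set ℓ
  Dfn₂ R = Dfn {2} λ a → R (a 0F) (a 1F)

  ⇔d : (∀ a → P a ⇔ Q a) → Dfn P → Dfn Q
  ⇔d eq (dfn (m , φ , b , h)) = dfn
    (m , φ , b , λ a → mk⇔ (to (h a) ∘ from (eq a)) (to (eq a) ∘ from (h a)))

  private
    assign : ∀ {m m′} → (Fin n → Fin k) → (Fin m → Fin m′) → Fin (n +ℕ m) → Fin (k +ℕ m′)
    assign {n} {k} {m} {m′} σ τ i = [ (λ j → σ j ↑ˡ m′) , (λ j → k ↑ʳ τ j) ]′ (splitAt n i)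

    assign-++ : ∀ {m m′} (σ : Fin n → Fin k) (τ : Fin m → Fin m′)
                (a : Vector Carrier k) (b : Vector Carrier m) (b′ : Vector Carrier m′) →
                (∀ j → b′ (τ j) ≡ b j) →
                ∀ i → (a ++ᵛ b′) (assign σ τ i) ≈ ((a ∘ σ) ++ᵛ b) i
    assign-++ {n} σ τ a b b′ eq i with splitAt n i
    ... | inj₁ j = reflexive (lookup-++ˡ a b′ (σ j))
    ... | inj₂ j = reflexive (≡.trans (lookup-++ʳ a b′ (τ j)) (eq j))

    reindex : ∀ {m m′} (σ : Fin n → Fin k) (τ : Fin m → Fin m′)
              (b : Vector Carrier m) (b′ : Vector Carrier m′) → (∀ j → b′ (τ j) ≡ b j) →
              ∀ φ → (∀ a → P a ⇔ Sat (a ++ᵛ b) φ) →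
              ∀ a → P (a ∘ σ) ⇔ Sat (a ++ᵛ b′) (rename (assign σ τ) φ)
    reindex σ τ b b′ eq φ h a = mk⇔
      (from (Sat-rename (assign σ τ) (assign-++ σ τ a b b′ eq) φ) ∘ to (h (a ∘ σ)))
      (from (h (a ∘ σ)) ∘ to (Sat-rename (assign σ τ) (assign-++ σ τ a b b′ eq) φ))

    -- Both formulas are reindexed into the concatenation of their parameter vectors. `Sat-∙` says
    -- that the syntactic connective means `_⊙_`.
    binary : (_∙_ : ∀ {j} → Formula (L-div ⊕ E) j → Formula (L-div ⊕ E) j → Formula (L-div ⊕ E) j)
             {_⊙_ : Set ℓ → Set ℓ → Set ℓ} →
             (∀ {A A′ B B′} → A ⇔ A′ → B ⇔ B′ → (A ⊙ B) ⇔ (A′ ⊙ B′)) →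
             (∀ {j} (ρ : Vector Carrier j) φ ψ → Sat ρ (φ ∙ ψ) ≡ (Sat ρ φ ⊙ Sat ρ ψ)) →
             Dfn P → Dfn Q → Dfn (λ a → P a ⊙ Q a)
    binary _∙_ {_⊙_} cong Sat-∙ (dfn (m₁ , φ , b₁ , h₁)) (dfn (m₂ , ψ , b₂ , h₂)) = dfn
      ( m₁ +ℕ m₂ , rename _ φ ∙ rename _ ψ , b₁ ++ᵛ b₂ , λ a →
        ≡.subst (_ ⇔_) (≡.sym (Sat-∙ (a ++ᵛ (b₁ ++ᵛ b₂)) _ _))
          (cong (reindex id (_↑ˡ m₂) b₁ (b₁ ++ᵛ b₂) (lookup-++ˡ b₁ b₂) φ h₁ a)
                (reindex id (m₁ ↑ʳ_) b₂ (b₁ ++ᵛ b₂) (lookup-++ʳ b₁ b₂) ψ h₂ a)))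

  infixr 6 _∧d_
  infixr 5 _→d_

  _∧d_ : Dfn P → Dfn Q → Dfn (λ a → P a × Q a)
  _∧d_ = binary and
    (λ e e′ → mk⇔ (Prod.map (to e) (to e′)) (Prod.map (from e) (from e′)))
    (λ _ _ _ → ≡.refl)

  _→d_ : Dfn P → Dfn Q → Dfn (λ a → P a → Q a)
  _→d_ = binary imp
    (λ e e′ → mk⇔ (λ f → to e′ ∘ f ∘ from e) (λ f → from e′ ∘ f ∘ to e))
    (λ _ _ _ → ≡.refl)

  _∨d_ : Dfn P → Dfn Q → Dfn (λ a → P a ⊎ Q a)
  _∨d_ = binary or
    (λ e e′ → mk⇔ (Sum.map (to e) (to e′)) (Sum.map (from e) (from e′)))
    (λ _ _ _ → ≡.refl)

  ¬d : Dfn P → Dfn (λ a → ¬ P a)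
  ¬d (dfn (m , φ , b , h)) = dfn (m , imp φ false , b , λ a → mk⇔
    (λ ¬p s → Level.lift (¬p (from (h a) s)))
    (λ ¬s p → Level.lower (¬s (to (h a) p))))

  rename-vars : (σ : Fin n → Fin k) → Dfn P → Dfn (λ a → P (a ∘ σ))
  rename-vars σ (dfn (m , φ , b , h)) =
    dfn (m , rename (assign σ id) φ , b , reindex σ id b b (λ _ → ≡.refl) φ h)

  private
    ∷-++ : ∀ {m} x (a : Vector Carrier n) (b : Vector Carrier m) →
           ∀ i → (x ∷ᵛ (a ++ᵛ b)) i ≈ ((x ∷ᵛ a) ++ᵛ b) i
    ∷-++ {n} x a b zero = refl
    ∷-++ {n} x a b (suc i) with splitAt n i
    ... | inj₁ _ = refl
    ... | inj₂ _ = refl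

  ∃d : {P : Pred (Vector Carrier (1+ n)) ℓ} → Dfn P → Dfn (λ a → ∃[ x ] P (x ∷ᵛ a))
  ∃d (dfn (m , φ , b , h)) = dfn (m , ex (rename id φ) , b , λ a → mk⇔
    (λ (x , p) → x , from (Sat-rename id (∷-++ x a b) φ) (to (h (x ∷ᵛ a)) p))
    (λ (x , s) → x , from (h (x ∷ᵛ a)) (to (Sat-rename id (∷-++ x a b) φ) s)))

  ∀d : {P : Pred (Vector Carrier (1+ n)) ℓ} → Dfn P → Dfn (λ a → ∀ x → P (x ∷ᵛ a))
  ∀d (dfn (m , φ , b , h)) = dfn (m , all (rename id φ) , b , λ a → mk⇔
    (λ p x → from (Sat-rename id (∷-++ x a b) φ) (to (h (x ∷ᵛ a)) (p x)))
    (λ s x → from (h (x ∷ᵛ a)) (to (Sat-rename id (∷-++ x a b) φ) (s x))))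

  Dfn-resp : Dfn P → ∀ {a a′} → (∀ i → a i ≈ a′ i) → P a → P a′
  Dfn-resp (dfn (m , φ , b , h)) {a} {a′} eq p =
    from (h a′) (to (Sat-rename id (++-resp a a′ eq b) φ)
      (from (Sat-rename id (λ _ → refl) φ) (to (h a) p)))
    where
    ++-resp : ∀ {n m} (a a′ : Vector Carrier n) → (∀ i → a i ≈ a′ i) →
              (b : Vector Carrier m) → ∀ i → (a ++ᵛ b) i ≈ (a′ ++ᵛ b) i
    ++-resp {n} a a′ eq b i with splitAt n i
    ... | inj₁ j = eq j
    ... | inj₂ _ = refl

  private
    -- The renaming bridges `n` and `n +ℕ 0`, which are not the same by computation.
    pure : {P : Pred (Vector Carrier n) ℓ} (φ : Formula (L-div ⊕ E) n) → (∀ a → P a ⇔ Sat a φ) → Dfn P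
    pure {n} {P} φ h = dfn (0 , rename (_↑ˡ 0) φ , []ᵛ , λ a → mk⇔
      (λ p → from (Sat-rename (_↑ˡ 0) (λ i → reflexive (lookup-++ˡ a []ᵛ i)) φ) (to (h a) p))
      (λ s → from (h a) (to (Sat-rename (_↑ˡ 0) (λ i → reflexive (lookup-++ˡ a []ᵛ i)) φ) s)))

  var-d : (i : Fin n) → DFun (λ a → a i)
  var-d i = dfun (pure (equal (var zero) (var (suc i))) (λ a → mk⇔ id id))

  const-d : ∀ c → DFun {n} (λ _ → c)
  const-d {n} c = dfun (dfn
    (1 , equal (var zero) (var ((1+ n) ↑ʳ 0F)) , c ∷ᵛ []ᵛ , λ a →
     let eq = reflexive (lookup-++ʳ a (c ∷ᵛ []ᵛ) 0F) in
     mk⇔ (λ p → trans p (sym eq)) (λ p → trans p eq)))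

  -- A definable function need not be named by a term, so substitution is expressed by quantifying
  -- over its value: some x equals t and satisfies P.
  _[_]d : {P : Pred (Vector Carrier (1+ n)) ℓ} {t : Vector Carrier n → Carrier} →
          Dfn P → DFun t → Dfn (λ a → P (t a ∷ᵛ a))
  _[_]d {n} {P} {t} p t-d = ⇔d (λ a → mk⇔
      (λ (x , x≈ , px) → Dfn-resp p (λ { zero → x≈ ; (suc i) → refl }) px)
      (λ pt → t a , refl , pt))
    (∃d (graph t-d ∧d p))

  wk : {t : Vector Carrier n → Carrier} → DFun t → DFun {1+ n} (λ a → t (a ∘ suc))
  wk t-d = dfun (rename-vars (extend suc) (graph t-d))

  rel₁ : (R : Carrier → Set ℓ) {t : Vector Carrier n → Carrier} →
         Dfn₁ R → DFun t → Dfn (λ a → R (t a))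
  rel₁ R r t-d = _[_]d {P = λ a → R (a 0F)} (rename-vars (λ _ → zero) r) t-d

  rel₂ : (R : Carrier → Carrier → Set ℓ) {s t : Vector Carrier n → Carrier} →
         Dfn₂ R → DFun s → DFun t → Dfn (λ a → R (s a) (t a))
  rel₂ R {s = s} r s-d t-d =
    _[_]d {P = λ a → R (s (a ∘ suc)) (a 0F)}
      (_[_]d {P = λ a → R (a 0F) (a 1F)} (rename-vars (λ { 0F → 0F ; 1F → 1F }) r) (wk s-d))
      t-d

  fun₁ : (f : Carrier → Carrier) {t : Vector Carrier n → Carrier} →
         Dfn₂ (λ x y → y ≈ f x) → DFun t → DFun (λ a → f (t a))
  fun₁ f g t-d = dfun (_[_]d {P = λ a → a 1F ≈ f (a 0F)}
    (rename-vars (λ { 0F → 0F ; 1F → 1F }) g) (wk t-d))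

  fun₂ : (_∙_ : Carrier → Carrier → Carrier) {s t : Vector Carrier n → Carrier} →
         Dfn {3} (λ a → a 2F ≈ (a 0F ∙ a 1F)) → DFun s → DFun t → DFun (λ a → s a ∙ t a)
  fun₂ _∙_ {s} g s-d t-d = dfun
    (_[_]d {P = λ a → a 1F ≈ (s (a ∘ suc ∘ suc) ∙ a 0F)}
      (_[_]d {P = λ a → a 2F ≈ (a 0F ∙ a 1F)}
        (rename-vars (λ { 0F → 0F ; 1F → 1F ; 2F → 2F }) g) (wk (wk s-d)))
      (wk t-d))

  infixl 8 _+d_ _-d_
  infix  7 _≼d_ _≺d_

  _+d_ : {s t : Vector Carrier n → Carrier} → DFun s → DFun t → DFun (λ a → s a + t a)
  _+d_ = fun₂ _+_ (pure (equal (var 2F) (func (inj₁ addᵈ) (λ { 0F → var 0F ; 1F → var 1F })))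
                    (λ _ → mk⇔ id id))

  _-d_ : {s t : Vector Carrier n → Carrier} → DFun s → DFun t → DFun (λ a → s a - t a)
  s-d -d t-d = s-d +d fun₁ -_ (pure (equal (var 1F) (func (inj₁ negᵈ) (λ { 0F → var 0F })))
                                 (λ _ → mk⇔ id id)) t-d

  _≼d_ : {s t : Vector Carrier n → Carrier} → DFun s → DFun t → Dfn (λ a → v (s a) ≤⁺ v (t a))
  _≼d_ = rel₂ (λ x y → v x ≤⁺ v y) (pure (reln (inj₁ divᵈ) (λ { 0F → var 0F ; 1F → var 1F })) (λ _ → mk⇔ id id))

  _≺d_ : {s t : Vector Carrier n → Carrier} → DFun s → DFun t → Dfn (λ a → ¬ (v (t a) ≤⁺ v (s a)))
  s-d ≺d t-d = ¬d (t-d ≼d s-d)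

  infix 7 _≈d_

  _≈d_ : {s t : Vector Carrier n → Carrier} → DFun s → DFun t → Dfn (λ a → s a ≈ t a)
  _≈d_ = rel₂ _≈_ (pure (equal (var 0F) (var 1F)) (λ _ → mk⇔ id id))

-- Boolean combinations of balls

module Balls {ℓ} (em : ExcludedMiddle ℓ) (𝒱 : ValuedField ℓ) where
  open ValuedField 𝒱
  open ValuationOrder em 𝒱
  open Equivalence
  open RingProperties ring using (x∙y⁻¹≈ε⇒x≈y)

  ¬×⇒⊎ : {A B : Set ℓ} → ¬ (A × B) → ¬ A ⊎ ¬ B
  ¬×⇒⊎ {A} ¬p with em {A}
  ... | yes a = inj₂ λ b → ¬p (a , b)
  ... | no ¬a = inj₁ ¬a

  -- The radius of a ball is given here by an element of K; the point a is the
  -- closed ball with radius given by 0.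
  ball-induction :
    ∀ {t} (T : Pred Carrier ℓ → Set t) →
    (∀ {P Q} → P ≐ Q → T P → T Q) →
    (∀ a c → T (λ x → c ≼ x - a)) →
    (∀ a c → ¬ (c ≈ 0#) → T (λ x → c ≺ x - a)) →
    T (λ _ → ⊤) →
    (∀ {P} → T P → T (∁ P)) →
    (∀ {P Q} → T P → T Q → T (P ∩ Q)) →
    ∀ {P} → IsBooleanCombinationOfBalls 𝒱 P → T P
  ball-induction T T-resp T-closed T-open T-U T-∁ T-∩ (e , P⊆e , e⊆P) =
    T-resp (e⊆P , P⊆e) (go e)
    where
    go : ∀ e → T (⟦_⟧ 𝒱 e)
    go (closed a [ γ ]) with c , vc≈γ ← v-surjective γ = T-resp
      (≤⁺-trans (≈⁺⇒≤⁺ (≈⁺-sym vc≈γ)) , ≤⁺-trans (≈⁺⇒≤⁺ vc≈γ)) (T-closed a c)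
    go (closed a ⊤⁺) = T-resp
      (≤⁺-trans (≈⁺⇒≤⁺ (≈⁺-sym v0≈∞)) , ≤⁺-trans (≈⁺⇒≤⁺ v0≈∞)) (T-closed a 0#)
      where v0≈∞ = from (v-∞ 0#) refl
    go (open′ a ⊥₋) = T-resp (_ , _) T-U
    go (open′ a [ γ ]) with c , vc≈γ ← v-surjective γ = T-resp
      ((λ p → ≱⁺⇒<⁺ λ q → p (≤⁺-trans q (≈⁺⇒≤⁺ (≈⁺-sym vc≈γ)))) ,
       (λ p q → <⁺⇒≱⁺ p (≤⁺-trans q (≈⁺⇒≤⁺ vc≈γ))))
      (T-open a c (finite-value⇒≉0 vc≈γ))
    go (∁′ e) = T-∁ (go e)
    go (e ∩′ e′) = T-∩ (go e) (go e′)
    -- Unions are reduced to complements and intersections by De Morgan.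
    go (e ∪′ e′) = T-resp
      ((λ ¬q → stable λ ¬p → ¬q ((λ p → ¬p (inj₁ p)) , (λ p → ¬p (inj₂ p)))) ,
       (λ p (¬q , ¬q′) → [ ¬q , ¬q′ ]′ p))
      (T-∁ (T-∩ (T-∁ (go e)) (T-∁ (go e′))))

  LocallyConstantOffFinite : Pred Carrier ℓ → Set ℓ
  LocallyConstantOffFinite P = Σ[ F ∈ List Carrier ] ∀ x → ¬ Any (x ≈_) F →
    ∃[ c ] (¬ (c ≈ 0#) × ∀ y → c ≺ y - x → P y ⇔ P x)

  -- Balls of radius other than infinity are open and closed, so only the centres of the closed
  -- balls of radius infinity can be exceptional.
  locally-constant : ∀ {P} → IsBooleanCombinationOfBalls 𝒱 P → LocallyConstantOffFinite P
  locally-constant = ball-induction LocallyConstantOffFinite resp closed-case open-case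
    ([] , λ x _ → 1# , 1≉0 , λ _ _ → mk⇔ id id)
    (λ (F , h) → F , λ x x∉F → let c , c≉0 , eq = h x x∉F in
      c , c≉0 , λ y p → mk⇔ (_∘ from (eq y p)) (_∘ to (eq y p)))
    ∩-case
    where
    resp : ∀ {P Q} → P ≐ Q → LocallyConstantOffFinite P → LocallyConstantOffFinite Q
    resp (P⊆Q , Q⊆P) (F , h) = F , λ x x∉F → let c , c≉0 , eq = h x x∉F in
      c , c≉0 , λ y p → mk⇔ (P⊆Q ∘ to (eq y p) ∘ Q⊆P) (P⊆Q ∘ from (eq y p) ∘ Q⊆P)

    closed-case : ∀ a c → LocallyConstantOffFinite (λ x → c ≼ x - a)
    closed-case a c with em {c ≈ 0#}
    ... | no c≉0 = [] , λ x _ → c , c≉0 , λ y p →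
            mk⇔ (Δ-≼ (flip-≼ (≺⇒≼ p))) (Δ-≼ (≺⇒≼ p))
    ... | yes c≈0 = a ∷ [] , λ x x∉ → x - a , (λ q → x∉ (here (x∙y⁻¹≈ε⇒x≈y x a q))) , λ y p →
            mk⇔ (λ q → ⊥-elim (p (≼-trans (proj₁ (Δ-sym y x)) (≼-reflexive
                  (+-congˡ (-‿cong (x∙y⁻¹≈ε⇒x≈y y a (0≼⇒≈0 (≼-respˡ c≈0 q)))))))))
                (λ q → ⊥-elim (x∉ (here (x∙y⁻¹≈ε⇒x≈y x a (0≼⇒≈0 (≼-respˡ c≈0 q))))))

    open-case : ∀ a c → ¬ (c ≈ 0#) → LocallyConstantOffFinite (λ x → c ≺ x - a)
    open-case a c c≉0 = [] , λ x _ → c , c≉0 , λ y p → mk⇔ (Δ-≺ (flip-≺ p)) (Δ-≺ p)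

    ∩-case : ∀ {P Q} → LocallyConstantOffFinite P → LocallyConstantOffFinite Q →
             LocallyConstantOffFinite (P ∩ Q)
    ∩-case (F , h) (G , k) = F ++ G , λ x x∉ →
      let c , c≉0 , eq  = h x (x∉ ∘ Anyₚ.++⁺ˡ)
          d , d≉0 , eq′ = k x (x∉ ∘ Anyₚ.++⁺ʳ F)
          both : ∀ y → c ≺ y - x → d ≺ y - x → _
          both y p q = mk⇔ (λ (u , w) → to (eq y p) u , to (eq′ y q) w)
                           (λ (u , w) → from (eq y p) u , from (eq′ y q) w)
      in [ (λ c≼d → d , d≉0 , λ y p → both y (≼≺-trans c≼d p) p)
         , (λ d≼c → c , c≉0 , λ y p → both y p (≼≺-trans d≼c p)) ]′ (≼-total c d)

  -- The trace of a boolean combination of balls on the value group is a finite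
  -- union of intervals and points: membership of x depends only on the position
  -- of v x relative to finitely many values.
  Tame : Pred Carrier ℓ → Set ℓ
  Tame S = Σ[ G ∈ List Carrier ] ∀ {x y} → x ≼ y → All (λ g → g ≺ x ⊎ y ≺ g) G → S x ⇔ S y

  -- For a ball with centre `a` and radius `c` the critical values are those of `a` and `c`: v(x -
  -- a) equals v(x) when this is below v(a), and v(a) when it is above.
  tame : ∀ {S} → IsBooleanCombinationOfBalls 𝒱 S → Tame S
  tame = ball-induction Tame
    (λ (P⊆Q , Q⊆P) (G , h) → G , λ p q →
      mk⇔ (P⊆Q ∘ to (h p q) ∘ Q⊆P) (P⊆Q ∘ from (h p q) ∘ Q⊆P))
    closed-case
    open-case
    ([] , λ _ _ → mk⇔ id id)
    (λ (G , h) → G , λ p q → mk⇔ (_∘ from (h p q)) (_∘ to (h p q)))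
    (λ (F , h) (G , k) → F ++ G , λ p q →
      let e = h p (Allₚ.++⁻ˡ F q) ; e′ = k p (Allₚ.++⁻ʳ F q) in
      mk⇔ (λ (u , w) → to e u , to e′ w) (λ (u , w) → from e u , from e′ w))
    where
    same-distance : ∀ {x y a} → x ≼ y → a ≺ x → x - a ∼ y - a
    same-distance x≼y a≺x = ∼-trans (near-center a≺x) (∼-sym (near-center (≺≼-trans a≺x x≼y)))

    closed-case : ∀ a c → Tame (λ x → c ≼ x - a)
    closed-case a c = a ∷ c ∷ [] , λ {x} {y} → λ where
      x≼y (inj₁ a≺x ∷ _ ∷ []) → let p , q = same-distance x≼y a≺x in
        mk⇔ (λ r → ≼-trans r p) (λ r → ≼-trans r q)
      x≼y (inj₂ y≺a ∷ inj₁ c≺x ∷ []) → mk⇔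
        (λ _ → ≼-trans (≼-trans (≺⇒≼ c≺x) x≼y) (proj₂ (far y≺a)))
        (λ _ → ≼-trans (≺⇒≼ c≺x) (proj₂ (far (≼≺-trans x≼y y≺a))))
      x≼y (inj₂ y≺a ∷ inj₂ y≺c ∷ []) → mk⇔
        (λ r → ⊥-elim (≼≺-trans x≼y y≺c (≼-trans r (proj₁ (far (≼≺-trans x≼y y≺a))))))
        (λ r → ⊥-elim (y≺c (≼-trans r (proj₁ (far y≺a)))))

    open-case : ∀ a c → ¬ (c ≈ 0#) → Tame (λ x → c ≺ x - a)
    open-case a c _ = a ∷ c ∷ [] , λ {x} {y} → λ where
      x≼y (inj₁ a≺x ∷ _ ∷ []) → let p , q = same-distance x≼y a≺x in
        mk⇔ (λ r → ≺≼-trans r p) (λ r → ≺≼-trans r q)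
      x≼y (inj₂ y≺a ∷ inj₁ c≺x ∷ []) → mk⇔
        (λ _ → ≺≼-trans (≺≼-trans c≺x x≼y) (proj₂ (far y≺a)))
        (λ _ → ≺≼-trans c≺x (proj₂ (far (≼≺-trans x≼y y≺a))))
      x≼y (inj₂ y≺a ∷ inj₂ y≺c ∷ []) → mk⇔
        (λ r → ⊥-elim (≺-irrefl (≺-trans r (≼≺-trans (proj₁ (far (≼≺-trans x≼y y≺a))) (≼≺-trans x≼y y≺c)))))
        (λ r → ⊥-elim (≺-irrefl (≺-trans r (≼≺-trans (proj₁ (far y≺a)) y≺c))))

  -- The open balls of radius d inside the closed ball b of radius d round x₀ are
  -- indexed by the residue field; U is small when U ∩ b lies in finitely many.
  module ResidueClasses (x₀ d : Carrier) where

    Small : Pred Carrier ℓ → Set ℓ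
    Small P = Σ[ F ∈ List Carrier ] ∀ {y} → d ≼ y - x₀ → P y → Any (λ x → d ≺ y - x) F

    small-⊆ : ∀ {P Q} → (∀ {y} → d ≼ y - x₀ → P y → Q y) → Small Q → Small P
    small-⊆ P⊆Q (F , h) = F , λ y∈b → h y∈b ∘ P⊆Q y∈b

    small-∪ : ∀ {P Q} → Small P → Small Q → Small (P ∪ Q)
    small-∪ (F , h) (G , k) = F ++ G , λ y∈b → [ Anyₚ.++⁺ˡ ∘ h y∈b , Anyₚ.++⁺ʳ F ∘ k y∈b ]′

    -- A ball lies within one class, contains `b`, or misses `b`. Thus the residue field is minimal:
    -- the traces are finite or cofinite.
    small-or-cosmall : ∀ {P} → IsBooleanCombinationOfBalls 𝒱 P → Small P ⊎ Small (∁ P)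
    small-or-cosmall = ball-induction (λ P → Small P ⊎ Small (∁ P))
      (λ (P⊆Q , Q⊆P) → [ (λ s → inj₁ (small-⊆ (λ _ → Q⊆P) s))
                       , (λ s → inj₂ (small-⊆ (λ _ → _∘ P⊆Q) s)) ]′)
      closed-case
      open-case
      (inj₂ ([] , λ _ ¬u → ⊥-elim (¬u tt)))
      [ (λ s → inj₂ (small-⊆ (λ _ → stable) s)) , inj₁ ]′
      ∩-case
      where
      closed-case : ∀ a c → Small (λ x → c ≼ x - a) ⊎ Small (∁ λ x → c ≼ x - a)
      closed-case a c with compare c d | em {c ≼ x₀ - a}
      ... | inj₂ d≺c | _     = inj₁ (a ∷ [] , λ _ p → here (≺≼-trans d≺c p))
      ... | inj₁ c≼d | yes p = inj₂ ([] , λ y∈b ¬q → ⊥-elim (¬q (Δ-≼ (≼-trans c≼d y∈b) p)))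
      ... | inj₁ c≼d | no ¬p = inj₁ ([] , λ y∈b q → ⊥-elim (¬p (Δ-≼ (flip-≼ (≼-trans c≼d y∈b)) q)))

      open-case : ∀ a c → ¬ (c ≈ 0#) → Small (λ x → c ≺ x - a) ⊎ Small (∁ λ x → c ≺ x - a)
      open-case a c _ with compare d c | em {c ≺ x₀ - a}
      ... | inj₁ d≼c | _     = inj₁ (a ∷ [] , λ _ p → here (≼≺-trans d≼c p))
      ... | inj₂ c≺d | yes p = inj₂ ([] , λ y∈b ¬q → ⊥-elim (¬q (Δ-≺ (≺≼-trans c≺d y∈b) p)))
      ... | inj₂ c≺d | no ¬p = inj₁ ([] , λ y∈b q → ⊥-elim (¬p (Δ-≺ (flip-≺ (≺≼-trans c≺d y∈b)) q)))

      ∩-case : ∀ {P Q} → Small P ⊎ Small (∁ P) → Small Q ⊎ Small (∁ Q) →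
               Small (P ∩ Q) ⊎ Small (∁ (P ∩ Q))
      ∩-case (inj₁ s) _        = inj₁ (small-⊆ (λ _ → proj₁) s)
      ∩-case (inj₂ _) (inj₁ s) = inj₁ (small-⊆ (λ _ → proj₂) s)
      ∩-case (inj₂ s) (inj₂ t) = inj₂ (small-⊆ (λ _ → ¬×⇒⊎) (small-∪ s t))

    -- A class meeting both `P` and its complement is listed by whichever of the two is small.
    split-classes-small : ∀ {P} → IsBooleanCombinationOfBalls 𝒱 P →
      Small (λ y → ∃[ z ] ∃[ w ] (d ≺ z - y × d ≺ w - y × P z × ¬ P w))
    split-classes-small {P} bc with small-or-cosmall bc
    ... | inj₁ (F , h) = F , λ y∈b (z , _ , z∼y , _ , Pz , _) →
            Any.map (Δ-≺ (flip-≺ z∼y)) (h (Δ-≼ (≺⇒≼ z∼y) y∈b) Pz)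
    ... | inj₂ (F , h) = F , λ y∈b (_ , w , _ , w∼y , _ , ¬Pw) →
            Any.map (Δ-≺ (flip-≺ w∼y)) (h (Δ-≼ (≺⇒≼ w∼y) y∈b) ¬Pw)

-- Generic behaviour on the residue classes of a closed ball

module Infima {ℓ} (em : ExcludedMiddle ℓ) (𝒱 : ValuedField ℓ) (closed : AlgebraicallyClosed 𝒱) where
  open ValuedField 𝒱
  open ValuationOrder em 𝒱
  open AlgebraicallyClosedValuation em 𝒱 closed
  open Balls em 𝒱
  open Equivalence

  private
    insert : ∀ {a g x : Carrier} {G} → x ∈ₗ (a ∷ G) → x ∈ₗ (a ∷ g ∷ G)
    insert (here p)  = here p
    insert (there p) = there (there p)

  -- Infinity, as `0#`, closes the list of critical values, so that there is always a next one.
  next-value : ∀ G {e} → e ≺ 0# →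
    ∃[ e′ ] (e ≺ e′ × e′ ∈ₗ (0# ∷ G) × All (λ g → g ≼ e ⊎ e′ ≼ g) G)
  next-value [] e≺0 = 0# , e≺0 , here ≡.refl , []
  next-value (g ∷ G) {e} e≺0 with e′ , e≺e′ , e′∈ , gap ← next-value G e≺0
    with compare g e | compare g e′
  ... | inj₁ g≼e | _         = e′ , e≺e′ , insert e′∈ , inj₁ g≼e ∷ gap
  ... | inj₂ e≺g | inj₁ g≼e′ = g , e≺g , there (here ≡.refl) ,
          inj₂ ≼-refl ∷ All.map (Sum.map₂ (≼-trans g≼e′)) gap
  ... | inj₂ e≺g | inj₂ e′≺g = e′ , e≺e′ , insert e′∈ , inj₂ (≺⇒≼ e′≺g) ∷ gap

  gap⇒⇔ : ∀ {S : Pred Carrier ℓ} {G e e′} →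
    (∀ {x y} → x ≼ y → All (λ g → g ≺ x ⊎ y ≺ g) G → S x ⇔ S y) →
    All (λ g → g ≼ e ⊎ e′ ≼ g) G →
    ∀ {x y} → e ≺ x → x ≺ e′ → e ≺ y → y ≺ e′ → S x → S y
  gap⇒⇔ h gap {x} {y} e≺x x≺e′ e≺y y≺e′ with ≼-total x y
  ... | inj₁ x≼y = to (h x≼y (All.map (Sum.map (λ p → ≼≺-trans p e≺x) (≺≼-trans y≺e′)) gap))
  ... | inj₂ y≼x = from (h y≼x (All.map (Sum.map (λ p → ≼≺-trans p e≺y) (≺≼-trans x≺e′)) gap))

  right-germ : ∀ {S e} → Tame S → e ≺ 0# →
    ∃[ e′ ] (e ≺ e′ × ∀ {x y} → e ≺ x → x ≺ e′ → e ≺ y → y ≺ e′ → S x → S y)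
  right-germ (G , h) e≺0 with e′ , e≺e′ , _ , gap ← next-value G e≺0 =
    e′ , e≺e′ , gap⇒⇔ h gap

  -- The empty set has infimum `0#`, for which the second clause is vacuous.
  IsInfimum : Pred Carrier ℓ → Carrier → Set ℓ
  IsInfimum S e = (∀ g → S g → e ≼ g) × (∀ e′ → e ≺ e′ → ∃[ g ] (S g × g ≺ e′))

  infimum-unique : ∀ {S e e′} → IsInfimum S e → IsInfimum S e′ → e ∼ e′
  infimum-unique i j = half i j , half j i
    where
    half : ∀ {S e e′} → IsInfimum S e → IsInfimum S e′ → e ≼ e′
    half (lower , _) (_ , approx) = stable λ e′≺e → let g , Sg , g≺e = approx _ e′≺e in
      g≺e (lower g Sg)

  infimum-∼ : ∀ {S e e′} → e ∼ e′ → IsInfimum S e → IsInfimum S e′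
  infimum-∼ (e≼e′ , e′≼e) (lower , approx) =
    (λ g Sg → ≼-trans e′≼e (lower g Sg)) , (λ e″ p → approx e″ (≼≺-trans e≼e′ p))

  largest : ∀ {Q : Pred Carrier ℓ} {x} → Q x → ∀ L →
    ∃[ e ] (Q e × x ≼ e × All (λ g → Q g → g ≼ e) L)
  largest {x = x} Qx [] = x , Qx , ≼-refl , []
  largest {Q} Qx (g ∷ L) with e , Qe , x≼e , max ← largest Qx L
    with em {Q g} | compare g e
  ... | no ¬Qg | _        = e , Qe , x≼e , (⊥-elim ∘ ¬Qg) ∷ max
  ... | yes _  | inj₁ g≼e = e , Qe , x≼e , (λ _ → g≼e) ∷ max
  ... | yes Qg | inj₂ e≺g = g , Qg , ≼-trans x≼e (≺⇒≼ e≺g) ,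
          (λ _ → ≼-refl) ∷ All.map (λ h → λ q → ≼-trans (h q) (≺⇒≼ e≺g)) max

  below-both : ∀ {e x y} → e ≺ x → e ≺ y → ∃[ m ] (e ≺ m × m ≺ x × m ≺ y)
  below-both {x = x} {y} e≺x e≺y with ≼-total x y
  ... | inj₁ x≼y = let m , p , q = dense e≺x in m , p , q , ≺≼-trans q x≼y
  ... | inj₂ y≼x = let m , p , q = dense e≺y in m , p , ≺≼-trans q y≼x , q

  -- Take the largest lower bound `e` among `l`, `0#` and the critical values. The next critical
  -- value is not a lower bound, so `S` has a point below it. If this point is above `e`, tameness
  -- puts the whole gap above `e` into `S`, and no lower bound exceeds `e`.
  infimum : ∀ {S l} → Tame S → (∀ g → S g → l ≼ g) → ∃ (IsInfimum S)
  infimum {S} (G , h) l≼S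
    with e , lower , _ , max ← largest {Q = λ e → ∀ g → S g → e ≼ g} l≼S (0# ∷ G) =
    e , lower , λ e′ e≺e′ → stable λ none → contradiction e′ e≺e′
      (λ g Sg → stable λ g≺e′ → none (g , Sg , g≺e′))
    where
    contradiction : ∀ e′ → e ≺ e′ → ¬ (∀ g → S g → e′ ≼ g)
    contradiction e′ e≺e′ e′≼S
      with e″ , e≺e″ , e″∈ , gap ← next-value G (≺≼-trans e≺e′ x≼0)
      with m , e≺m , m≺e′ , m≺e″ ← below-both e≺e′ e≺e″ =
        e≺e″ (All.lookup max e″∈ λ g Sg → stable λ g≺e″ → m≺e′ (e′≼S m
          (gap⇒⇔ {S} h gap (≺≼-trans e≺e′ (e′≼S g Sg)) g≺e″ e≺m m≺e″ Sg)))

  -- A set missing its infimum `e` has points just above `e`, hence contains everything just above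
  -- `e`; its complement cannot accumulate there.
  infimum-not-isolated : ∀ {S e s} → Tame S → (∀ {g g′} → g ∼ g′ → S g → S g′) →
    e ≺ 0# → s ≼ e → ¬ S e → IsInfimum S e → ¬ IsInfimum (λ g → e ≺ g × ¬ S g) s
  infimum-not-isolated S-tame S-∼ e≺0 s≼e ¬Se (lower , approx) (_ , approx′)
    with e′ , e≺e′ , constant ← right-germ S-tame e≺0
    with g , Sg , g≺e′ ← approx e′ e≺e′
    with g′ , (e≺g′ , ¬Sg′) , g′≺e′ ← approx′ e′ (≼≺-trans s≼e e≺e′) =
      ¬Sg′ (constant (λ g≼e → ¬Se (S-∼ (g≼e , lower g Sg) Sg)) g≺e′ e≺g′ g′≺e′ Sg)

-- Small unions of definable families of classes

module GenericBehaviour {ℓ} (em : ExcludedMiddle ℓ) {E : Language ℓ} (𝒦 : Expansion E)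
                        (cmin : CMinimal 𝒦)
                        (x₀ d : Expansion.Carrier 𝒦)
                        (d≉0 : ¬ (Expansion._≈_ 𝒦 d (Expansion.0# 𝒦))) where
  open Expansion 𝒦
  open ValuationOrder em valuedField
  open AlgebraicallyClosedValuation em valuedField (proj₁ cmin)
  open Balls em valuedField
  open ResidueClasses x₀ d
  open Infima em valuedField (proj₁ cmin)
  open DefinableSets 𝒦
  open Equivalence

  abstract
    dfn-tame : ∀ P → Dfn₁ P → Tame P
    dfn-tame P p = tame (proj₂ cmin 𝒦 (λ _ → mk⇔ id id) P (definable p))

    dfn-small-or-cosmall : ∀ P → Dfn₁ P → Small P ⊎ Small (∁ P)
    dfn-small-or-cosmall P p = small-or-cosmall (proj₂ cmin 𝒦 (λ _ → mk⇔ id id) P (definable p))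

    dfn-split-classes-small : ∀ P → Dfn₁ P →
      Small (λ y → ∃[ z ] ∃[ w ] (d ≺ z - y × d ≺ w - y × P z × ¬ P w))
    dfn-split-classes-small P p =
      split-classes-small (proj₂ cmin 𝒦 (λ _ → mk⇔ id id) P (definable p))

  -- The residue field is infinite; `d ≼ d` serves as the predicate that always holds.
  everything-not-small : ¬ Small (λ _ → d ≼ d)
  everything-not-small (F , h) = no-finite-cover F d≉0 (λ y y∈b → h y∈b ≼-refl)

  small-Any : ∀ {P : Carrier → Carrier → Set ℓ} → (∀ e → Small (P e)) → ∀ L →
              Small (λ y → Any (λ e → P e y) L)
  small-Any small []      = [] , λ _ ()
  small-Any small (e ∷ L) = small-⊆ (λ _ → λ { (here p) → inj₁ p ; (there p) → inj₂ p })
                              (small-∪ (small e) (small-Any small L))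

  module _ (R : Carrier → Carrier → Set ℓ) (r : Dfn₂ R)
           (R-class : ∀ {g y y′} → d ≺ y - y′ → R g y → R g y′)
           {l} (l≼R : ∀ {g y} → d ≼ y - x₀ → R g y → l ≼ g) where

    private
      -- For generic y the infimum does not depend on y: otherwise the attained
      -- infima fill an interval, and for m inside it both {y : inf < m} and
      -- {y : inf > m} meet infinitely many classes, contradicting C-minimality.
      Inf : Carrier → Carrier → Set ℓ
      Inf e y = IsInfimum (λ g → R g y) e

      Attained : Carrier → Set ℓ
      Attained e = ∃[ y ] (d ≼ y - x₀ × Inf e y)

      abstract
        inf-d : Dfn₂ Inf
        inf-d = ∀d (rel₂ R r (var-d 0F) (var-d 2F) →d (var-d 1F ≼d var-d 0F))
             ∧d ∀d (var-d 1F ≺d var-d 0F →d ∃d (rel₂ R r (var-d 0F) (var-d 3F) ∧d (var-d 0F ≺d var-d 1F)))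

        attained-tame : Tame Attained
        attained-tame = dfn-tame Attained
          (∃d ((const-d d ≼d var-d 0F -d const-d x₀) ∧d rel₂ Inf inf-d (var-d 1F) (var-d 0F)))

        attained-below : ∀ m → let P = λ y → ∃[ e ] (e ≺ m × Inf e y) in Small P ⊎ Small (∁ P)
        attained-below m = dfn-small-or-cosmall (λ y → ∃[ e ] (e ≺ m × Inf e y))
          (∃d ((var-d 0F ≺d const-d m) ∧d rel₂ Inf inf-d (var-d 0F) (var-d 1F)))

        attained-above : ∀ m → let P = λ y → ∃[ e ] (m ≺ e × Inf e y) in Small P ⊎ Small (∁ P)
        attained-above m = dfn-small-or-cosmall (λ y → ∃[ e ] (m ≺ e × Inf e y))
          (∃d ((const-d m ≺d var-d 0F) ∧d rel₂ Inf inf-d (var-d 0F) (var-d 1F)))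

        attained-at : ∀ e → Small (Inf e) ⊎ Small (∁ (Inf e))
        attained-at e = dfn-small-or-cosmall (Inf e) (rel₂ Inf inf-d (const-d e) (var-d 0F))

        inf-exists : ∀ {y} → d ≼ y - x₀ → ∃[ e ] Inf e y
        inf-exists {y} y∈b = infimum
          (dfn-tame (λ g → R g y) (rel₂ R r (var-d 0F) (const-d y))) (λ g → l≼R y∈b)

      inf-class : ∀ {e y y′} → d ≺ y - y′ → Inf e y → Inf e y′
      inf-class y∼y′ (lower , approx) =
        (λ g Rgy′ → lower g (R-class (flip-≺ y∼y′) Rgy′)) ,
        (λ e′ e≺e′ → let g , Rgy , g≺e′ = approx e′ e≺e′ in g , R-class y∼y′ Rgy , g≺e′)

      -- Each point of `F` has at most one infimum up to `_∼_`. Cutting the interval at that value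
      -- leaves a lower part free of it.
      avoid : ∀ F {s t} → s ≺ t → ∃[ s′ ] ∃[ t′ ] (s ≼ s′ × s′ ≺ t′ × t′ ≼ t ×
                (∀ {e} → s′ ≺ e → e ≺ t′ → ¬ Any (Inf e) F))
      avoid [] s≺t = _ , _ , ≼-refl , s≺t , ≼-refl , λ _ _ ()
      avoid (x ∷ F) s≺t with s′ , t′ , s≼s′ , s′≺t′ , t′≼t , h ← avoid F s≺t
        with em {∃[ e ] (s′ ≺ e × e ≺ t′ × Inf e x)}
      ... | no none = s′ , t′ , s≼s′ , s′≺t′ , t′≼t ,
              λ { p q (here i) → none (_ , p , q , i) ; p q (there a) → h p q a }
      ... | yes (e , s′≺e , e≺t′ , i) = s′ , e , s≼s′ , s′≺e , ≼-trans (≺⇒≼ e≺t′) t′≼t ,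
              λ { p q (here j) → q (proj₁ (infimum-unique i j))
                ; p q (there a) → h p (≺-trans q e≺t′) a }
      -- By `inf-class` a class carries a single infimum, so finitely many classes account for
      -- finitely many values, and an interval has others.
      interval-not-small : ∀ {s t} → s ≺ t → (∀ {e} → s ≺ e → e ≺ t → Attained e) →
        ∀ {P} → (∀ {e y} → s ≺ e → e ≺ t → Inf e y → P y) → ¬ Small P
      interval-not-small s≺t att P⊇ (F , h)
        with s′ , t′ , s≼s′ , s′≺t′ , t′≼t , avoids ← avoid F s≺t
        with e , s′≺e , e≺t′ ← dense s′≺t′
        with s≺e ← ≼≺-trans s≼s′ s′≺e | e≺t ← ≺≼-trans e≺t′ t′≼t
        with y , y∈b , i ← att s≺e e≺t =
          avoids s′≺e e≺t′ (Any.map (λ p → inf-class p i) (h y∈b (P⊇ s≺e e≺t i)))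

      -- Tameness applies from `e` itself onwards because `e` is not a critical value.
      attained-gap : ∀ {e e′ x} → Attained e → ¬ Any (e ∼_) (proj₁ attained-tame) →
        All (λ g → g ≼ e ⊎ e′ ≼ g) (proj₁ attained-tame) → e ≺ x → x ≺ e′ → Attained x
      attained-gap att e∉G gap e≺x x≺e′ = to (proj₂ attained-tame (≺⇒≼ e≺x) (All.zipWith (λ where
        (inj₁ g≼e  , e≁g) → inj₁ (λ e≼g → e≁g (e≼g , g≼e))
        (inj₂ e′≼g , _)   → inj₂ (≺≼-trans x≺e′ e′≼g))
        (gap , Allₚ.¬Any⇒All¬ (proj₁ attained-tame) e∉G))) att

      no-attained-interval : ∀ {s t} → s ≺ t → ¬ (∀ {x} → s ≺ x → x ≺ t → Attained x)
      no-attained-interval {s} {t} s≺t att with m , s≺m , m≺t ← dense s≺t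
        with attained-below m | attained-above m
      ... | inj₁ small | _          = interval-not-small s≺m
              (λ s≺x x≺m → att s≺x (≺-trans x≺m m≺t)) (λ _ x≺m i → _ , x≺m , i) small
      ... | inj₂ _     | inj₁ small = interval-not-small m≺t
              (λ m≺x → att (≺-trans s≺m m≺x)) (λ m≺x _ i → _ , m≺x , i) small
      -- No `y` has infima on both sides of `m`, so two small complements would cover everything.
      ... | inj₂ cosmall | inj₂ cosmall′ = everything-not-small (small-⊆
              (λ _ _ → ¬×⇒⊎ λ ((x , x≺m , i) , (x′ , m≺x′ , i′)) →
                ≺-irrefl (≺-trans x≺m (≺≼-trans m≺x′ (proj₁ (infimum-unique i′ i)))))
              (small-∪ cosmall cosmall′))

      -- An attained value other than `0#` and the critical values would start an attained interval.
      -- Hence finitely many of the sets `Inf e` cover `b`, and they cannot all be small.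
      not-all-small : ¬ (∀ e → Small (Inf e))
      not-all-small all-small = everything-not-small (small-⊆
        (λ y∈b _ → let e , i = inf-exists y∈b in
          Any.map (λ e∼g → infimum-∼ e∼g i) (stable (finite e (_ , y∈b , i))))
        (small-Any all-small (0# ∷ proj₁ attained-tame)))
        where
        finite : ∀ e → Attained e → ¬ ¬ Any (e ∼_) (0# ∷ proj₁ attained-tame)
        finite e att e∉G
          with e′ , e≺e′ , _ , gap ← next-value (proj₁ attained-tame) (λ 0≼e → e∉G (here (x≼0 , 0≼e))) =
            no-attained-interval e≺e′ (attained-gap att (e∉G ∘ there) gap)

    abstract
      generic-infimum : ∃[ e ] Small (λ y → ¬ IsInfimum (λ g → R g y) e)
      generic-infimum = stable λ none → not-all-small λ e →
        [ id , (λ s → ⊥-elim (none (e , s))) ]′ (attained-at e)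

  by-cases : ∀ {A B : Set ℓ} → (A → B) → ¬ A ⊎ B
  by-cases {A} f with em {A}
  ... | yes a = inj₂ (f a)
  ... | no ¬a = inj₁ ¬a

  -- If the union were not small, then for generic y the set {g : R g y} would have
  -- a fixed infimum e without containing it, hence by tameness would contain an
  -- interval (e , s), again fixed; but then the fibres over (e , s) are not small.
  abstract
    small-union-of-infima : (R : Carrier → Carrier → Set ℓ) →
      (∀ y → Tame (λ g → R g y)) →
      (∀ {g g′ y} → d ≼ y - x₀ → g ∼ g′ → R g y → R g′ y) →
      (∀ g → Small (R g)) →
      ∀ e s → Small (λ y → ¬ IsInfimum (λ g → R g y) e) →
      Small (λ y → ¬ IsInfimum (λ g → e ≺ g × ¬ R g y) s) →
      Small (λ y → ∃[ g ] R g y)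
    small-union-of-infima R R-tame R-∼ fibres-small e s cosmall cosmall′
      with compare 0# e | compare s e
    -- A generic infimum of infinity leaves only the fibre over `0#`.
    ... | inj₁ 0≼e | _ = small-⊆
          (λ {y} y∈b (g , Rgy) → by-cases {A = IsInfimum (λ g → R g y) e} λ i →
            R-∼ y∈b (x≼0 , ≼-trans 0≼e (proj₁ i g Rgy)) Rgy)
          (small-∪ cosmall (fibres-small 0#))
    -- For generic `y` the fibre over `e` is avoided, and non-members would then accumulate just
    -- above an infimum that is not attained.
    ... | inj₂ e≺0 | inj₁ s≼e = ⊥-elim (everything-not-small (small-⊆
          (λ {y} y∈b _ → stable λ none → infimum-not-isolated
            (R-tame y) (R-∼ y∈b) e≺0 s≼e
            (λ Rey → none (inj₂ (inj₁ Rey)))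
            (stable λ ¬i → none (inj₁ ¬i))
            (stable λ ¬i → none (inj₂ (inj₂ ¬i))))
          (small-∪ cosmall (small-∪ (fibres-small e) cosmall′))))
    ... | inj₂ _   | inj₂ e≺s = let m , e≺m , m≺s = dense e≺s in
          ⊥-elim (everything-not-small (small-⊆
            (λ {y} _ _ → by-cases {A = IsInfimum (λ g → e ≺ g × ¬ R g y) s} λ i →
              stable λ ¬Rmy → m≺s (proj₁ i m (e≺m , ¬Rmy)))
            (small-∪ cosmall′ (fibres-small m))))

    -- Generic infima are taken twice: of the indices that hold at `y`, then of those above the
    -- first infimum that fail. The bound `l` ensures that the first exists.
    small-union : (R : Carrier → Carrier → Set ℓ) → Dfn₂ R →
      (∀ {g y y′} → d ≺ y - y′ → R g y → R g y′) →
      (∀ {g g′ y} → d ≼ y - x₀ → g ∼ g′ → R g y → R g′ y) →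
      ∀ {l} → (∀ {g y} → d ≼ y - x₀ → R g y → l ≼ g) →
      (∀ g → Small (R g)) →
      Small (λ y → ∃[ g ] R g y)
    small-union R r R-class R-∼ l≼R fibres-small = small-union-of-infima R
      (λ y → dfn-tame (λ g → R g y) (rel₂ R r (var-d 0F) (const-d y)))
      R-∼ fibres-small (proj₁ inf) (proj₁ inf′) (proj₂ inf) (proj₂ inf′)
      where
      inf : ∃[ e ] Small (λ y → ¬ IsInfimum (λ g → R g y) e)
      inf = generic-infimum R r R-class l≼R
      inf′ : ∃[ s ] Small (λ y → ¬ IsInfimum (λ g → proj₁ inf ≺ g × ¬ R g y) s)
      inf′ = generic-infimum (λ g y → proj₁ inf ≺ g × ¬ R g y)
        ((const-d (proj₁ inf) ≺d var-d 0F) ∧d ¬d (rel₂ R r (var-d 0F) (var-d 1F)))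
        (λ y∼y′ (e≺g , ¬Rgy) → e≺g , λ Rgy′ → ¬Rgy (R-class (flip-≺ y∼y′) Rgy′))
        {proj₁ inf} (λ _ (e≺g , _) → ≺⇒≼ e≺g)

-- Local factorization

module Factorization {ℓ} (em : ExcludedMiddle ℓ) {E : Language ℓ} (𝒦 : Expansion E)
                     (cmin : CMinimal 𝒦)
                     (f : Expansion.setoid 𝒦 ⇀ Expansion.setoid 𝒦)
                     (f-definable : Expansion.DefinableMap 𝒦 f)
                     (f-local : IsLocalCIsomorphism (Expansion.valuedField 𝒦) f) where
  open Expansion 𝒦
  open RingProperties ring
  open ValuationOrder em valuedField
  open AlgebraicallyClosedValuation em valuedField (proj₁ cmin)
  open Balls em valuedField
  open DefinableSets 𝒦
  open Equivalence

  -- Extending `f` by zero makes it a total definable function that can be substituted into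
  -- formulas.
  f̂ : Carrier → Carrier
  f̂ x with em {dom f x}
  ... | yes p = app f x p
  ... | no  _ = 0#

  f̂≈app : ∀ {x} (p : dom f x) → f̂ x ≈ app f x p
  f̂≈app {x} p with em {dom f x}
  ... | yes q = _⇀_.app-cong f q p refl
  ... | no ¬p = ⊥-elim (¬p p)

  f̂≈0 : ∀ {x} → ¬ dom f x → f̂ x ≈ 0#
  f̂≈0 {x} ¬p with em {dom f x}
  ... | yes p = ⊥-elim (¬p p)
  ... | no _  = refl

  abstract
    dom-d : Dfn₁ (dom f)
    dom-d = ⇔d (λ a → mk⇔ (λ (_ , p , _) → p) (λ p → _ , p , refl))
      (∃d (rel₂ (Graph f) (dfn f-definable) (var-d 1F) (var-d 0F)))

    f̂-graph : Dfn₂ (λ x y → y ≈ f̂ x)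
    f̂-graph = ⇔d {P = λ a → Graph f (a 0F) (a 1F) ⊎ (¬ dom f (a 0F) × a 1F ≈ 0#)}
      (λ a → mk⇔
        [ (λ (p , eq) → trans (sym eq) (sym (f̂≈app p)))
        , (λ (¬p , eq) → trans eq (sym (f̂≈0 ¬p))) ]′
        (λ eq → split eq))
      (dfn f-definable ∨d (¬d (rel₁ (dom f) dom-d (var-d 0F)) ∧d (var-d 1F ≈d const-d 0#)))
      where
      split : ∀ {x y} → y ≈ f̂ x → Graph f x y ⊎ (¬ dom f x × y ≈ 0#)
      split {x} eq with em {dom f x}
      ... | yes p = inj₁ (p , sym eq)
      ... | no ¬p = inj₂ (¬p , eq)

  f̂-d : ∀ {n} {t : _ → Carrier} → DFun {n} t → DFun (λ a → f̂ (t a))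
  f̂-d = fun₁ f̂ f̂-graph

  f̂-cong : ∀ {x y} → x ≈ y → f̂ x ≈ f̂ y
  f̂-cong {x} {y} x≈y = Dfn-resp f̂-graph {x ∷ᵛ f̂ x ∷ᵛ []ᵛ} {y ∷ᵛ f̂ x ∷ᵛ []ᵛ}
    (λ { 0F → x≈y ; 1F → refl }) refl

  PreservesOrderOn : Carrier → Carrier → Set ℓ
  PreservesOrderOn x₀ ρ = ∀ {x y z} → ρ ≺ x - x₀ → ρ ≺ y - x₀ → ρ ≺ z - x₀ →
    (x - y ≺ x - z) ⇔ (f̂ x - f̂ y ≺ f̂ x - f̂ z)

  -- The equality demanded by `C` is automatic: in an ultrametric triangle `x - y ≺ x - z` forces
  -- v(y - x) = v(y - z).
  C⇔≺ : ∀ {x y z} → C valuedField y x z ⇔ (x - y ≺ x - z)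
  C⇔≺ {x} {y} {z} = mk⇔
    (λ (p , q) → ≼≺-trans (proj₁ (Δ-sym x y)) (≼≺-trans (proj₁ (≈⁺⇒∼ p)) (<⁺⇒≱⁺ q)))
    (λ p → let y-x≺x-z = ≼≺-trans (proj₂ (Δ-sym x y)) p ; i = isosceles y-x≺x-z in
      ∼⇒≈⁺ (∼-sym i) , ≱⁺⇒<⁺ (≼≺-trans (proj₁ i) y-x≺x-z))

  -- Every point of an open ball is a centre. For radius -∞ the choice of `1#` is arbitrary.
  radius-in-K : ∀ {a x} γ → OpenBall valuedField a γ x →
    ∃[ ρ ] (¬ (ρ ≈ 0#) × (∀ {y} → ρ ≺ y - x → OpenBall valuedField a γ y))
  radius-in-K ⊥₋    _   = 1# , 1≉0 , _
  radius-in-K {x = x} [ γ ] x∈B with c , vc≈γ ← v-surjective γ =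
    c , finite-value⇒≉0 vc≈γ , λ c≺y-x → ≱⁺⇒<⁺ λ q →
      Δ-≺ c≺y-x (λ r → <⁺⇒≱⁺ x∈B (≤⁺-trans r (≈⁺⇒≤⁺ vc≈γ)))
        (≤⁺-trans q (≈⁺⇒≤⁺ (≈⁺-sym vc≈γ)))

  local-order : ∀ {x} → dom f x → ∃[ ρ ] (¬ (ρ ≈ 0#) ×
    (∀ {y} → ρ ≺ y - x → dom f y) × PreservesOrderOn x ρ)
  local-order {x} p with a , γ , x∈B , B⊆dom , _ , _ , iso ← f-local x p
    with ρ , ρ≉0 , ball⊆B ← radius-in-K {a} γ x∈B =
      ρ , ρ≉0 , (λ {y} q → B⊆dom {y} (ball⊆B q)) , λ {x} {y} {z} p q r →
        order (iso y x z (B⊆dom (ball⊆B q) , ball⊆B q) (B⊆dom (ball⊆B p) , ball⊆B p)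
                         (B⊆dom (ball⊆B r) , ball⊆B r))
    where
    order : ∀ {x y z} {p : dom f x} {q : dom f y} {r : dom f z} →
      C valuedField y x z ⇔ C valuedField (app f y q) (app f x p) (app f z r) →
      (x - y ≺ x - z) ⇔ (f̂ x - f̂ y ≺ f̂ x - f̂ z)
    order {p = p} {q} {r} iso = mk⇔
      (λ h → ≺-resp (sym (f̂-Δ p q)) (sym (f̂-Δ p r)) (to C⇔≺ (to iso (from C⇔≺ h))))
      (λ h → to C⇔≺ (from iso (from C⇔≺ (≺-resp (f̂-Δ p q) (f̂-Δ p r) h))))
      where
      f̂-Δ : ∀ {x y} (p : dom f x) (q : dom f y) → f̂ x - f̂ y ≈ app f x p - app f y q
      f̂-Δ p q = +-cong (f̂≈app p) (-‿cong (f̂≈app q))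

  ∼d : ∀ {n} {s t : _ → Carrier} → DFun {n} s → DFun t → Dfn (λ a → s a ∼ t a)
  ∼d s-d t-d = (s-d ≼d t-d) ∧d (t-d ≼d s-d)

  -- The value of a difference of images is a function of the value of the difference. Leaving that
  -- function unnamed keeps `Good` first-order.
  FactorizesOn : Carrier → Carrier → Set ℓ
  FactorizesOn x r = ∀ x₁ y₁ x₂ y₂ → r ≺ x₁ - x → r ≺ y₁ - x → r ≺ x₂ - x → r ≺ y₂ - x →
    x₁ - y₁ ∼ x₂ - y₂ → f̂ x₁ - f̂ y₁ ∼ f̂ x₂ - f̂ y₂

  Good : Carrier → Set ℓ
  Good x = ∃[ r ] (¬ (r ≈ 0#) × FactorizesOn x r)

  abstract
    good-d : Dfn₁ Good
    -- Inside all quantifiers, 5 is `x`, 4 is `r`, and 3 down to 0 are `x₁`, `y₁`, `x₂`, `y₂`.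
    good-d = ∃d (¬d (var-d 0F ≈d const-d 0#) ∧d ∀d (∀d (∀d (∀d
      (   (var-d 4F ≺d var-d 3F -d var-d 5F)
       →d (var-d 4F ≺d var-d 2F -d var-d 5F)
       →d (var-d 4F ≺d var-d 1F -d var-d 5F)
       →d (var-d 4F ≺d var-d 0F -d var-d 5F)
       →d ∼d (var-d 3F -d var-d 2F) (var-d 1F -d var-d 0F)
       →d ∼d (f̂-d (var-d 3F) -d f̂-d (var-d 2F)) (f̂-d (var-d 1F) -d f̂-d (var-d 0F)))))))

  -- Existence of good points

  module GenericPoint (x₀ ρ : Carrier) (ρ≺0 : ρ ≺ 0#) (order : PreservesOrderOn x₀ ρ) where

    same-distance : ∀ {x y z} → ρ ≺ x - x₀ → ρ ≺ y - x₀ → ρ ≺ z - x₀ →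
      x - y ∼ x - z → f̂ x - f̂ y ∼ f̂ x - f̂ z
    same-distance p q r (y≼z , z≼y) =
      stable (λ h → from (order p r q) h y≼z) , stable (λ h → from (order p q r) h z≼y)

    private
      -- The values satisfy ρ < d₁ < d < ∞, and `d` is the radius of `b`. The point `w` is outside
      -- `b` but inside the ball where `f̂` preserves the order.
      d₁ d w : Carrier
      d₁ = proj₁ (dense ρ≺0)
      ρ≺d₁ : ρ ≺ d₁
      ρ≺d₁ = proj₁ (proj₂ (dense ρ≺0))
      d₁≺0 : d₁ ≺ 0#
      d₁≺0 = proj₂ (proj₂ (dense ρ≺0))
      d = proj₁ (dense d₁≺0)
      d₁≺d : d₁ ≺ d
      d₁≺d = proj₁ (proj₂ (dense d₁≺0))
      d≉0 : ¬ (d ≈ 0#)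
      d≉0 = ≺⇒≉0 (proj₂ (proj₂ (dense d₁≺0)))
      w = x₀ + d₁

    open ResidueClasses x₀ d
    open GenericBehaviour em 𝒦 cmin x₀ d d≉0

    private
      -- For `z` in `b` and `d ≺ c`, the value of `H z c` is the local value function h_z at v(c).
      H : Carrier → Carrier → Carrier
      H z c = f̂ (z + c) - f̂ z

      H-d : ∀ {n} {s t : _ → Carrier} → DFun {n} s → DFun t → DFun (λ a → H (s a) (t a))
      H-d s-d t-d = f̂-d (s-d +d t-d) -d f̂-d s-d

      in-b : ∀ {y z} → d ≼ y - x₀ → d ≺ z - y → d ≼ z - x₀
      in-b y∈b z∼y = Δ-≼ (≺⇒≼ z∼y) y∈b

      in-ball : ∀ {z} → d ≼ z - x₀ → ρ ≺ z - x₀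
      in-ball = ≺≼-trans (≺-trans ρ≺d₁ d₁≺d)

      d≼step : ∀ {z c} → d ≺ c → d ≼ (z + c) - z
      d≼step d≺c = ≼-respʳ (sym ([x+y]-x≈y _ _)) (≺⇒≼ d≺c)

      step-in-ball : ∀ {z c} → d ≼ z - x₀ → d ≺ c → ρ ≺ (z + c) - x₀
      step-in-ball z∈b d≺c = in-ball (Δ-≼ (d≼step d≺c) z∈b)

      step∼ : ∀ z c → z - (z + c) ∼ c
      step∼ z c = ∼-trans (Δ-sym z (z + c)) (∼-reflexive ([x+y]-x≈y z c))

      H∼ : ∀ {z c y} → d ≼ z - x₀ → d ≺ c → ρ ≺ y - x₀ → c ∼ y - z → H z c ∼ f̂ y - f̂ z
      H∼ {z} {c} {y} z∈b d≺c y∈ball c∼ =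
        ∼-trans (Δ-sym _ _) (∼-trans
          (same-distance (in-ball z∈b) (step-in-ball z∈b d≺c) y∈ball
            (∼-trans (step∼ z c) (∼-trans c∼ (Δ-sym y z))))
          (Δ-sym _ _))

      -- The point `w` is farther from `z` than `z + c` is, and equally far from `z` and `x₀`; both
      -- facts pass through `f̂`. The bound is uniform in `z`, as infima of jump levels require.
      H-lower-bound : ∀ {z c} → d ≼ z - x₀ → d ≺ c → f̂ w - f̂ x₀ ≼ H z c
      H-lower-bound {z} {c} z∈b d≺c = ≼-trans
        (proj₁ (∼-trans (∼-sym (same-distance w∈ball (in-ball z∈b) x₀∈ball w-z∼w-x₀)) (Δ-sym _ _)))
        (≼-trans (≺⇒≼ (to (order (in-ball z∈b) w∈ball (step-in-ball z∈b d≺c)) z-w≺)) (proj₁ (Δ-sym _ _)))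
        where
        w-x₀≈d₁ : w - x₀ ≈ d₁
        w-x₀≈d₁ = [x+y]-x≈y x₀ d₁
        w∈ball : ρ ≺ w - x₀
        w∈ball = ≺-respʳ (sym w-x₀≈d₁) ρ≺d₁
        x₀∈ball : ρ ≺ x₀ - x₀
        x₀∈ball = ≺-respʳ (sym (-‿inverseʳ x₀)) ρ≺0
        w-z∼w-x₀ : w - z ∼ w - x₀
        w-z∼w-x₀ = isosceles (≺≼-trans (≺-resp (sym w-x₀≈d₁) refl d₁≺d) (flip-≼ z∈b))
        z-w≺ : z - w ≺ z - (z + c)
        z-w≺ = ≼≺-trans (proj₁ (∼-trans (Δ-sym z w) (∼-trans w-z∼w-x₀ (∼-reflexive w-x₀≈d₁))))
          (≺≼-trans (≺-trans d₁≺d d≺c) (proj₂ (step∼ z c)))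

      -- A jump means that h_z at v(c) varies with `z` in the class of `y`. `JumpAt` adds a level
      -- `g` separating two of its values, which supplies an index for a union.
      Jump : Carrier → Carrier → Set ℓ
      Jump c y = ∃[ z₁ ] ∃[ z₂ ] (d ≺ z₁ - y × d ≺ z₂ - y × H z₁ c ≺ H z₂ c)

      JumpAt : Carrier → Carrier → Carrier → Set ℓ
      JumpAt c g y = ∃[ z₁ ] ∃[ z₂ ] (d ≺ z₁ - y × d ≺ z₂ - y × H z₁ c ≺ g × g ≼ H z₂ c)

      abstract
        jump-d : Dfn₂ (λ c y → d ≺ c × Jump c y)
        jump-d = (const-d d ≺d var-d 0F) ∧d ∃d (∃d
          (  (const-d d ≺d var-d 1F -d var-d 3F)
          ∧d (const-d d ≺d var-d 0F -d var-d 3F)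
          ∧d (H-d (var-d 1F) (var-d 2F) ≺d H-d (var-d 0F) (var-d 2F))))

        jump-at-d : ∀ c → Dfn₂ (JumpAt c)
        jump-at-d c = ∃d (∃d
          (  (const-d d ≺d var-d 1F -d var-d 3F)
          ∧d (const-d d ≺d var-d 0F -d var-d 3F)
          ∧d (H-d (var-d 1F) (const-d c) ≺d var-d 2F)
          ∧d (var-d 2F ≼d H-d (var-d 0F) (const-d c))))

        -- A class with a jump at level `g` is split by the definable set where `H z c ≺ g`.
        jump-at-small : ∀ c g → Small (JumpAt c g)
        jump-at-small c g = small-⊆
          (λ _ (z₁ , z₂ , p , q , h , k) → z₁ , z₂ , p , q , h , (λ h′ → h′ k))
          (dfn-split-classes-small (λ z → H z c ≺ g) (H-d (var-d 0F) (const-d c) ≺d const-d g))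

        jump-small : ∀ {c} → d ≺ c → Small (Jump c)
        jump-small {c} d≺c = small-⊆
          -- The larger of the two values is itself a separating level.
          (λ _ (z₁ , z₂ , p , q , h) → H z₂ c , z₁ , z₂ , p , q , h , ≼-refl)
          (small-union (JumpAt c) (jump-at-d c)
            (λ y∼y′ (z₁ , z₂ , p , q , h) → z₁ , z₂ , Δ-≺ p y∼y′ , Δ-≺ q y∼y′ , h)
            (λ _ (g≼g′ , g′≼g) (z₁ , z₂ , p , q , h , k) →
              z₁ , z₂ , p , q , ≺≼-trans h g≼g′ , ≼-trans g′≼g k)
            {f̂ w - f̂ x₀}
            (λ y∈b (z₁ , z₂ , p , q , h , k) →
              ≼-trans (H-lower-bound (in-b y∈b p) d≺c) (≺⇒≼ h))
            (jump-at-small c))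

        -- The second union runs over the step `c`, bounded below by `d`; its fibres are small by
        -- the first union, over levels, or empty when `c ≼ d`.
        jumps-small : Small (λ y → ∃[ c ] (d ≺ c × Jump c y))
        jumps-small = small-union (λ c y → d ≺ c × Jump c y) jump-d
          (λ y∼y′ (d≺c , z₁ , z₂ , p , q , h) → d≺c , z₁ , z₂ , Δ-≺ p y∼y′ , Δ-≺ q y∼y′ , h)
          (λ y∈b (c≼c′ , c′≼c) (d≺c , z₁ , z₂ , p , q , h) →
            let d≺c′ = ≺≼-trans d≺c c≼c′ in
            d≺c′ , z₁ , z₂ , p , q ,
            ≼≺-trans (proj₂ (H-∼ (in-b y∈b p) d≺c d≺c′ (c≼c′ , c′≼c)))
              (≺≼-trans h (proj₁ (H-∼ (in-b y∈b q) d≺c d≺c′ (c≼c′ , c′≼c)))))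
          {d} (λ _ (d≺c , _) → ≺⇒≼ d≺c)
          (λ c → [ (λ c≼d → [] , λ {_} _ (d≺c , _) → ⊥-elim (d≺c c≼d))
                 , (λ d≺c → small-⊆ (λ _ → proj₂) (jump-small d≺c)) ]′ (compare c d))
          where
          H-∼ : ∀ {z c c′} → d ≼ z - x₀ → d ≺ c → d ≺ c′ → c ∼ c′ → H z c ∼ H z c′
          H-∼ {z} {c′ = c′} z∈b d≺c d≺c′ c∼c′ = H∼ z∈b d≺c (step-in-ball z∈b d≺c′)
            (∼-trans c∼c′ (∼-reflexive (sym ([x+y]-x≈y z c′))))

      no-jump⇒factorizes : ∀ {y} → d ≼ y - x₀ → ¬ (∃[ c ] (d ≺ c × Jump c y)) → FactorizesOn y d
      no-jump⇒factorizes {y} y∈b none x₁ y₁ x₂ y₂ p₁ q₁ p₂ q₂ eq =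
        ∼-trans (difference p₁ q₁ eq₁) (∼-trans
          (stable (λ h → none (c , d≺c , x₂ , x₁ , p₂ , p₁ , h)) ,
           stable (λ h → none (c , d≺c , x₁ , x₂ , p₁ , p₂ , h)))
          (∼-sym (difference p₂ q₂ (∼-trans eq₁ eq))))
        where
        -- One step of the common value serves both pairs: their image distances become those of
        -- `H x₁ c` and `H x₂ c`, which agree for want of a jump.
        c = y₁ - x₁
        d≺c : d ≺ c
        d≺c = Δ-≺ q₁ (flip-≺ p₁)
        eq₁ : c ∼ x₁ - y₁
        eq₁ = Δ-sym y₁ x₁
        difference : ∀ {x′ y′} → d ≺ x′ - y → d ≺ y′ - y → c ∼ x′ - y′ → f̂ x′ - f̂ y′ ∼ H x′ c
        difference p q c∼ = ∼-trans (Δ-sym _ _) (∼-sym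
          (H∼ (in-b y∈b p) d≺c (in-ball (in-b y∈b q)) (∼-trans c∼ (Δ-sym _ _))))

    abstract
      -- Without a good point every class of `b` would have a jump, but only finitely many do.
      good-point : ∃[ y ] (ρ ≺ y - x₀ × Good y)
      good-point = stable λ none → everything-not-small (small-⊆
        (λ {y} y∈b _ → stable λ no-jump →
          none (y , in-ball y∈b , d , d≉0 , no-jump⇒factorizes y∈b no-jump))
        jumps-small)

  -- Finiteness of the set of bad points

  Bad : Carrier → Set ℓ
  Bad x = dom f x × ¬ Good x

  shrink : ∀ {x₀ ρ r} → ρ ≼ r → PreservesOrderOn x₀ ρ → PreservesOrderOn x₀ r
  shrink ρ≼r order p q r = order (≼≺-trans ρ≼r p) (≼≺-trans ρ≼r q) (≼≺-trans ρ≼r r)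

  max-radius : ∀ {c ρ} → ¬ (c ≈ 0#) → ¬ (ρ ≈ 0#) → ∃[ r ] (¬ (r ≈ 0#) × c ≼ r × ρ ≼ r)
  max-radius {c} {ρ} c≉0 ρ≉0 = [ (λ c≼ρ → ρ , ρ≉0 , c≼ρ , ≼-refl)
                               , (λ ρ≼c → c , c≉0 , ≼-refl , ρ≼c) ]′ (≼-total c ρ)

  abstract
    bad-d : Dfn₁ Bad
    bad-d = dom-d ∧d ¬d good-d

    bad-locally-constant : LocallyConstantOffFinite Bad
    bad-locally-constant = locally-constant (proj₂ cmin 𝒦 (λ _ → mk⇔ id id) Bad (definable bad-d))

    -- Off the exceptional list a bad point has a ball of bad points around it, and that ball
    -- contains a good point.
    bad⊆ : ∀ x → Bad x → Any (x ≈_) (proj₁ bad-locally-constant)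
    bad⊆ x bad = stable (no-bad-ball ∘ proj₂ bad-locally-constant x)
      where
      no-bad-ball : ¬ (∃[ c ] (¬ (c ≈ 0#) × ∀ y → c ≺ y - x → Bad y ⇔ Bad x))
      no-bad-ball (c , c≉0 , same)
        with ρ , ρ≉0 , _ , order ← local-order (proj₁ bad)
        with r , r≉0 , c≼r , ρ≼r ← max-radius c≉0 ρ≉0
        with y , r≺y-x , good ← GenericPoint.good-point x r (≉0⇒≺0 r≉0) (shrink ρ≼r order) =
          proj₂ (from (same y (≼≺-trans c≼r r≺y-x)) bad) good

    -- The exceptional list may contain points that are not bad. Filtering them out puts `F` inside
    -- the domain and away from the good points.
    bad-points : Σ[ F ∈ List Carrier ] (All Bad F × ∀ x → Bad x → Any (x ≈_) F)
    bad-points = let F , bads , complete = select (proj₁ bad-locally-constant) in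
      F , bads , λ x bad → complete bad (bad⊆ x bad)
      where
      bad-resp : ∀ {x y} → x ≈ y → Bad x → Bad y
      bad-resp {x} {y} x≈y = Dfn-resp bad-d {x ∷ᵛ []ᵛ} {y ∷ᵛ []ᵛ} (λ { 0F → x≈y })
      select : ∀ G → Σ[ F ∈ List Carrier ]
        (All Bad F × ∀ {x} → Bad x → Any (x ≈_) G → Any (x ≈_) F)
      select [] = [] , [] , λ _ ()
      select (g ∷ G) with F , bads , complete ← select G with em {Bad g}
      ... | yes bad = g ∷ F , bad ∷ bads ,
              λ { _ (here p) → here p ; bad (there q) → there (complete bad q) }
      ... | no ¬bad = F , bads ,
              λ { bad (here x≈g) → ⊥-elim (¬bad (bad-resp x≈g bad))
                ; bad (there q) → complete bad q }

  -- Asking this of all z makes δ unique, so h needs no mention of balls.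
  HasValue : Carrier → Γ.Carrier → Γ.Carrier → Set ℓ
  HasValue x γ δ = ∀ z → v (x - z) ≈⁺ [ γ ] → dom f z × v (f̂ x - f̂ z) ≈⁺ [ δ ]

  HasValue-unique : ∀ {x x′ γ γ′ δ δ′} → x ≈ x′ → γ Γ.≈ γ′ →
    HasValue x γ δ → HasValue x′ γ′ δ′ → δ Γ.≈ δ′
  HasValue-unique {x} {x′} {γ} x≈x′ γ≈γ′ h h′ with w , vw≈γ ← v-surjective γ =
    SupEq.[≈]-injective Γ._≈_ (≈⁺-trans (≈⁺-sym (proj₂ (h z vxz)))
      (≈⁺-trans (v-cong (+-congʳ (f̂-cong x≈x′))) (proj₂ (h′ z vx′z))))
    where
    -- A point at distance γ from `x` is needed, since otherwise `HasValue` would hold vacuously for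
    -- every δ.
    z = x - w
    vxz : v (x - z) ≈⁺ [ γ ]
    vxz = ≈⁺-trans (v-cong (trans (+-congˡ (⁻¹-anti-homo‿- x w)) (x+[y-x]≈y x w))) vw≈γ
    vx′z = ≈⁺-trans (v-cong (+-congʳ (sym x≈x′))) (≈⁺-trans vxz SupEq.[ γ≈γ′ ])

  HasValue-resp : ∀ {x x′ γ γ′ δ δ′} → x ≈ x′ → γ Γ.≈ γ′ → δ Γ.≈ δ′ →
    HasValue x γ δ → HasValue x′ γ′ δ′
  HasValue-resp x≈x′ γ≈γ′ δ≈δ′ h z p
    with q , r ← h z (≈⁺-trans (v-cong (+-congʳ x≈x′)) (≈⁺-trans p SupEq.[ Γ.sym γ≈γ′ ])) =
      q , ≈⁺-trans (v-cong (+-congʳ (f̂-cong (sym x≈x′)))) (≈⁺-trans r SupEq.[ δ≈δ′ ])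

  h : ×-setoid setoid Γ.setoid ⇀ Γ.setoid
  h = record
    -- Goodness of `x` makes the first coordinates avoid `F`.
    { dom      = λ (x , γ) → dom f x × Good x × ∃ (HasValue x γ)
    ; dom-resp = λ {(x , _)} {(y , _)} (x≈y , γ≈γ′) (p , good , δ , val) →
        _⇀_.dom-resp f x≈y p ,
        Dfn-resp good-d {x ∷ᵛ []ᵛ} {y ∷ᵛ []ᵛ} (λ { 0F → x≈y }) good ,
        δ , HasValue-resp x≈y γ≈γ′ Γ.refl val
    ; app      = λ _ (_ , _ , δ , _) → δ
    ; app-cong = λ (_ , _ , _ , val) (_ , _ , _ , val′) (x≈y , γ≈γ′) →
        HasValue-unique x≈y γ≈γ′ val val′
    }

  private
    -- The two sets are the graph of `h` pulled back along v and its first-order form in K, where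
    -- nonzero elements name the members of Γ.
    GraphInK GraphOverΓ : Vector Carrier 3 → Set ℓ
    GraphInK a = (¬ (a 1F ≈ 0#) × ¬ (a 2F ≈ 0#)) × (dom f (a 0F) × Good (a 0F) ×
      (∀ z → a 0F - z ∼ a 1F → dom f z × f̂ (a 0F) - f̂ z ∼ a 2F))
    GraphOverΓ a = Σ[ γ ∈ Vector Γ.Carrier 2 ]
      ((∀ i → v (a (suc i)) ≈⁺ [ γ i ]) × Graph h (a 0F , γ 0F) (γ 1F))

    to-graph : ∀ a → GraphInK a → GraphOverΓ a
    to-graph a ((a₁≉0 , a₂≉0) , p , good , val)
      with γ , va₁≈γ ← finite-value a₁≉0 | δ , va₂≈δ ← finite-value a₂≉0 =
      γ ∷ᵛ δ ∷ᵛ []ᵛ , (λ { 0F → va₁≈γ ; 1F → va₂≈δ }) ,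
      (p , good , δ , λ z q →
        let r , s = val z (≈⁺⇒∼ (≈⁺-trans q (≈⁺-sym va₁≈γ))) in
        r , ≈⁺-trans (∼⇒≈⁺ s) va₂≈δ) , Γ.refl

    from-graph : ∀ a → GraphOverΓ a → GraphInK a
    from-graph a (γ , va≈γ , (p , good , δ , val) , δ≈γ₁) =
      (finite-value⇒≉0 (va≈γ 0F) , finite-value⇒≉0 (va≈γ 1F)) , p , good , λ z q →
        let r , s = val z (≈⁺-trans (∼⇒≈⁺ q) (va≈γ 0F)) in
        r , ≈⁺⇒∼ (≈⁺-trans s (≈⁺-trans SupEq.[ δ≈γ₁ ] (≈⁺-sym (va≈γ 1F))))

    abstract
      graph-in-K-d : Dfn GraphInK
      graph-in-K-d =
        (¬d (var-d 1F ≈d const-d 0#) ∧d ¬d (var-d 2F ≈d const-d 0#)) ∧d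
        (rel₁ (dom f) dom-d (var-d 0F) ∧d (rel₁ Good good-d (var-d 0F) ∧d
        ∀d (∼d (var-d 1F -d var-d 0F) (var-d 2F) →d
          (rel₁ (dom f) dom-d (var-d 0F) ∧d ∼d (f̂-d (var-d 1F) -d f̂-d (var-d 0F)) (var-d 3F)))))

  h-definable : DefinableFamily h
  h-definable = definable {P = GraphOverΓ}
    (⇔d (λ a → mk⇔ (to-graph a) (from-graph a)) graph-in-K-d)

  F : List Carrier
  F = proj₁ bad-points

  good⇒∉F : ∀ {x} → Good x → ¬ Any (x ≈_) F
  good⇒∉F {x} good x∈F = go (proj₁ (proj₂ bad-points)) x∈F
    where
    go : ∀ {G} → All Bad G → ¬ Any (x ≈_) G
    go (bad ∷ _) (here x≈g) = proj₂ bad (Dfn-resp good-d {x ∷ᵛ []ᵛ} {_ ∷ᵛ []ᵛ} (λ { 0F → x≈g }) good)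
    go (_ ∷ bads) (there q)  = go bads q

  -- Order preservation is applied with `x` itself as third point: `y` is farther from `x` than `x`
  -- is.
  f̂-injective : ∀ {x₀ ρ x y} → PreservesOrderOn x₀ ρ → ρ ≺ x - x₀ → ρ ≺ y - x₀ →
    ¬ (x ≈ y) → ¬ (f̂ x - f̂ y ≈ 0#)
  f̂-injective {x = x} {y} order p q x≉y = ≺⇒≉0 (to (order p q p)
    (≺-respʳ (sym (-‿inverseʳ x)) (≉0⇒≺0 (x≉y ∘ x∙y⁻¹≈ε⇒x≈y x y))))

  locally-factorizes : LocallyFactorizesThrough valuedField (f ∖ F) h
  locally-factorizes = (λ x γ (p , good , _) → p , good⇒∉F good) , λ x (p , x∉F) →
    around x p (stable λ ¬good → x∉F (proj₂ (proj₂ bad-points) x (p , ¬good)))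
    where
    around : ∀ x → dom f x → Good x →
      ∃[ a ] ∃[ γ ] (OpenBall valuedField a γ x × OpenBall valuedField a γ ⊆ dom (f ∖ F) ×
        FactorizesThrough valuedField
          (restrict (f ∖ F) (OpenBall valuedField a γ) (OpenBall-resp valuedField a γ)) (section h x))
    around x p good@(s , s≉0 , factorizes)
      with ρ , ρ≉0 , ball⊆dom , order ← local-order p
      with r , r≉0 , s≼r , ρ≼r ← max-radius s≉0 ρ≉0
      with γ , vr≈γ ← finite-value r≉0 =
        x , [ γ ] , x∈B , (λ y∈B → ball⊆dom (≼≺-trans ρ≼r (ball y∈B)) , good⇒∉F (ball-good y∈B)) ,
        λ y z (p′ , y∈B) (q′ , z∈B) y≉z → values y z (ball y∈B) (ball z∈B) y≉z (proj₁ p′) (proj₁ q′)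
      where
      x≺ : r ≺ x - x
      x≺ = ≺-respʳ (sym (-‿inverseʳ x)) (≉0⇒≺0 r≉0)
      x∈B : OpenBall valuedField x [ γ ] x
      x∈B = ≱⁺⇒<⁺ λ q → x≺ (≤⁺-trans q (≈⁺⇒≤⁺ (≈⁺-sym vr≈γ)))
      ball : ∀ {y} → OpenBall valuedField x [ γ ] y → r ≺ y - x
      ball y∈B q = <⁺⇒≱⁺ y∈B (≤⁺-trans q (≈⁺⇒≤⁺ vr≈γ))
      ball-good : ∀ {y} → OpenBall valuedField x [ γ ] y → Good y
      ball-good {y} y∈B = s , s≉0 , λ x₁ y₁ x₂ y₂ p₁ q₁ p₂ q₂ →
        let recentre : ∀ {z} → s ≺ z - y → s ≺ z - x
            recentre p = Δ-≺ p (≼≺-trans s≼r (ball y∈B))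
        in factorizes x₁ y₁ x₂ y₂ (recentre p₁) (recentre q₁) (recentre p₂) (recentre q₂)
      values : ∀ y z → r ≺ y - x → r ≺ z - x → ¬ (y ≈ z) → (py : dom f y) (pz : dom f z) →
        ∃[ γ ] Σ[ q ∈ dom h (x , γ) ]
          ((v (y - z) ≈⁺ [ γ ]) × (v (app f y py - app f z pz) ≈⁺ [ app h (x , γ) q ]))
      values y z r≺y r≺z y≉z py pz
        with γ , vyz≈γ ← finite-value (y≉z ∘ x∙y⁻¹≈ε⇒x≈y y z)
        with δ , vfyz≈δ ← finite-value (f̂-injective (shrink ρ≼r order) r≺y r≺z y≉z) =
          γ , (p , good , δ , has-value) , vyz≈γ ,
          ≈⁺-trans (v-cong (sym (+-cong (f̂≈app py) (-‿cong (f̂≈app pz))))) vfyz≈δ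
        where
        -- Every `u` as far from `x` as `y` is from `z` stays in the ball, so the pair of `x` and
        -- `u` can be compared with that of `y` and `z`.
        has-value : HasValue x γ δ
        has-value u vxu≈γ = ball⊆dom (≼≺-trans ρ≼r u∈ball) , ≈⁺-trans (∼⇒≈⁺
          (factorizes x u y z (≼≺-trans s≼r x≺) (≼≺-trans s≼r u∈ball)
            (≼≺-trans s≼r r≺y) (≼≺-trans s≼r r≺z) xu∼yz)) vfyz≈δ
          where
          xu∼yz : x - u ∼ y - z
          xu∼yz = ≈⁺⇒∼ (≈⁺-trans vxu≈γ (≈⁺-sym vyz≈γ))
          u∈ball : r ≺ u - x
          u∈ball = flip-≺ (≺≼-trans (Δ-≺ r≺y (flip-≺ r≺z)) (proj₂ xu∼yz))

theorem3p3 : (∀ {a} → ExcludedMiddle a) →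
    (∀ {a b} → SetoidChoice a b) →
    ∀ {ℓ} (E : Language ℓ) (𝒦 : Expansion E) → let open Expansion 𝒦 in
    CMinimal 𝒦 →
    (f : setoid ⇀ setoid) →
    DefinableMap f →
    IsLocalCIsomorphism valuedField f →
    Σ[ F ∈ List Carrier ] (All (dom f) F ×
    Σ[ h ∈ (×-setoid setoid Γ.setoid ⇀ Γ.setoid) ]
    (DefinableFamily h ×
    LocallyFactorizesThrough valuedField (f ∖ F) h))
theorem3p3 em _ E 𝒦 cmin f f-definable f-local =
  F , All.map proj₁ (proj₁ (proj₂ bad-points)) , h , h-definable , locally-factorizes
  where open Factorization em 𝒦 cmin f f-definable f-local
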